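{- Let $n\ge 1$ and let $a=(a_1,\dots,a_n)$ be a weak composition (a sequence of $n$ nonnegative integers). Let $Q_b^a(\beta), M_b^a(\beta)\in\mathbb{Z}[\beta]$ be the coefficients in the expansions $$\overline{\mathfrak{A}}_a=\sum_b Q_b^a(\beta)\,\overline{\mathfrak{P}}_b,\qquad \overline{\mathfrak{Q}}_a=\sum_b M_b^a(\beta)\,\overline{\mathfrak{F}}_b$$ of the Lascoux atom $\overline{\mathfrak{A}}_a$ into kaons $\overline{\mathfrak{P}}_b$ and of the quasiLascoux polynomial $\overline{\mathfrak{Q}}_a$ into glide polynomials $\overline{\mathfrak{F}}_b$, where $b$ ranges over all weak compositions of length $n$. If the nonzero parts of $a$ are weakly decreasing (i.e. the sequence obtained from $a$ by deleting zeros is weakly decreasing from left to right), then $$\sum_b Q_b^a(-1)=\sum_b M_b^a(-1)=1,$$ and otherwise $$\sum_b Q_b^a(-1)=\sum_b M_b^a(-1)=0,$$ where the sums are taken over all weak compositions $b$.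
   Context: Fix $n\ge1$. A weak composition is a sequence $a=(a_1,\dots,a_n)$ of nonnegative integers; $|a|=a_1+\dots+a_n$; $a^+$ denotes the sequence of nonzero entries of $a$ in order; $\mathbf{x}^a=x_1^{a_1}\cdots x_n^{a_n}$. Write $b\ge a$ ($b$ dominates $a$) if $b_1+\dots+b_i\ge a_1+\dots+a_i$ for every $i$. Each of the four families below, indexed by all weak compositions of length $n$, is a basis of $\mathbb{Z}[x_1,\dots,x_n][\beta]$ over $\mathbb{Z}[\beta]$, so the coefficients $Q_b^a(\beta)$ and $M_b^a(\beta)$ are well defined (and only finitely many are nonzero for given $a$). **Kaons.** A weak komposition $b=(b_1,\dots,b_n)$ is a weak composition whose nonzero entries are each colored red or black; its excess $\mathrm{ex}(b)$ is the number of red entries, and the same notation is used for consecutive subsequences of $b$. Let $a$ have nonzero entries exactly at positions $n_1<n_2<\dots<n_\ell$, and set $n_0=0$. A weak komposition $b$ is a mesonic glide of $a$ if $b_i=0$ for all $i>n_\ell$ and, for every $1\le j\le\ell$: (1) $a_{n_j}=b_{n_{j-1}+1}+\dots+b_{n_j}-\mathrm{ex}(b_{n_{j-1}+1},\dots,b_{n_j})$; (2) the leftmost nonzero entry of $(b_{n_{j-1}+1},\dots,b_{n_j})$ is black; (3) $b_{n_j}\ne0$. (If $a=(0,\dots,0)$, take $\ell=0$, so the only mesonic glide is $(0,\dots,0)$.) The kaon is $\overline{\mathfrak{P}}_a=\sum_{b}\beta^{\mathrm{ex}(b)}\mathbf{x}^b$, the sum over all mesonic glides $b$ of $a$. **Lascoux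 atoms.** The skyline diagram of shape $a$ consists of $n$ left-justified rows of boxes, the $i$th row from the bottom (row $i$) having $a_i$ boxes. A set-valued skyline filling $T$ of shape $a$ fills each box with a nonempty finite set of positive integers. The largest entry of a box is its anchor; the other entries are free. $T$ is semistandard if: (S.1) There are no repeated entries in any column. (S.2) Entries weakly decrease along rows: the smallest entry of each box is at least the largest entry of the box immediately to its right. (S.3) Whenever anchors $\alpha,\beta,\gamma$ are such that (i) the box of $\alpha$ is immediately to the right of the box of $\beta$ in the same row, (ii) the row containing $\alpha$ and $\beta$ is at least as long as the row containing $\gamma$ if it is lower than the row of $\gamma$, and strictly longer if it is higher than the row of $\gamma$, and (iii) $\gamma$ is either above $\alpha$ in the same column as $\alpha$, or below $\beta$ in the same column as $\beta$, then $\gamma<\alpha$ or $\gamma>\beta$. (S.4) Each free entry lies in the box of its column with the smallest possible anchor such that (S.2) is satisfied. (S.5) Each anchor in the leftmost column equals the index of its row. Let $\overline{\mathfrak{A}}\mathsf{SSF}(a)$ be the set of semistandard set-valued skyline fillings of shape $a$. Let $\mathrm{wt}(T)$ be the weak composition whose $i$th part is the number of times $i$ appears as an entry in $T$, let $|T|$ be the total number of entries of $T$, and let $\mathrm{ex}(T)=|T|-|a|$ (the number of free entries). The Lascoux atom is $\overline{\mathfrak{A}}_a=\sum_{T\in\overline{\mathfrak{A}}\mathsf{SSF}(a)}\beta^{\mathrm{ex}(T)}\mathbf{x}^{\mathrm{wt}(T)}$. **Glide and quasiLascoux polynomials.** The glide polynomial is $\overline{\mathfrak{F}}_a=\sum_{b\ge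 a,\ b^+=a^+}\overline{\mathfrak{P}}_b$, and the quasiLascoux polynomial is $\overline{\mathfrak{Q}}_a=\sum_{b\ge a,\ b^+=a^+}\overline{\mathfrak{A}}_b$, the sums being over weak compositions $b$ of length $n$. -}

module Defs where

open import Data.Bool.Base using (true; false)
open import Data.Fin.Base as Fin using (Fin; zero; suc; toℕ)
import Data.Fin.Properties as Fin
open import Data.Fin.Subset using (Subset; Nonempty; ∣_∣; _∪_; _-_; ⁅_⁆; _∈_; _∉_)
open import Data.Fin.Subset.Properties using (_∈?_; nonempty?)
open import Data.Integer.Base as ℤ using (ℤ; 0ℤ; 1ℤ)
open import Data.List.Base as List using (List; []; _∷_; _++_; concatMap; cartesianProductWith)
import Data.List.Properties as List
open import Data.List.Membership.Propositional using () renaming (_∈_ to _∈ˡ_; _∉_ to _∉ˡ_)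
open import Data.List.Membership.Propositional.Properties
  using (∈-filter⁺; ∈-filter⁻; ∈-map⁺; ∈-++⁺ˡ; ∈-++⁺ʳ; ∈-upTo⁺; ∈-map⁻; ∈-cartesianProductWith⁺)
open import Data.List.Relation.Unary.All as All using (All)
open import Data.List.Relation.Unary.AllPairs as AllPairs using ()
open import Data.List.Relation.Unary.Any using (here; there)
open import Data.List.Relation.Unary.Linked using (Linked)
open import Data.List.Relation.Unary.Unique.Propositional using (Unique)
import Data.List.Relation.Unary.Unique.Propositional.Properties as Unique
open import Data.Nat.Base using (ℕ; zero; suc; _+_; _∸_; _≤_; _<_; _≥_; z≤n; s≤s)
import Data.Nat.Properties as ℕ
open import Data.Nat.ListAction using (sum)
open import Data.Product.Base using (∃; _×_; _,_; proj₁; proj₂)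
import Data.Product.Properties as Product
open import Data.Sum.Base using (_⊎_; inj₁; inj₂)
open import Data.Vec.Base as Vec using (Vec; []; _∷_; lookup; toList; tabulate)
import Data.Vec.Properties as Vec
open import Data.Vec.Relation.Unary.All as VecAll using ([]; _∷_)
import Data.Vec.Relation.Unary.All.Properties as VecAll
open import Function.Base using (_∘_)
open import Relation.Binary.Definitions using (DecidableEquality)
open import Relation.Binary.PropositionalEquality
  using (_≡_; _≢_; refl; cong; subst)
open import Relation.Nullary.Decidable
  using (Dec; yes; no; ¬?; map′; _×-dec_; _⊎-dec_; _→-dec_)
open import Relation.Nullary.Negation using (¬_)
open import Relation.Unary using (Decidable)

private
  variable
    A : Set
    m n : ℕ

record Finite (P : A → Set) : Set where
  field
    elements : List A
    unique   : Unique elements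
    sound    : ∀ {x} → x ∈ˡ elements → P x
    complete : ∀ {x} → P x → x ∈ˡ elements

open Finite public using (elements)

finite-filter : {P : A → Set} → Decidable P → (xs : List A) → Unique xs →
                (∀ {x} → P x → x ∈ˡ xs) → Finite P
finite-filter P? xs xs! P⇒∈ = record
  { elements = List.filter P? xs
  ; unique   = Unique.filter⁺ P? xs!
  ; sound    = λ x∈ → proj₂ (∈-filter⁻ P? {xs = xs} x∈)
  ; complete = λ px → ∈-filter⁺ P? (P⇒∈ px) px
  }

vectors : List A → (n : ℕ) → List (Vec A n)
vectors xs zero    = [] ∷ []
vectors xs (suc n) = cartesianProductWith _∷_ xs (vectors xs n)

vectors-unique : {xs : List A} → Unique xs → ∀ n → Unique (vectors xs n)
vectors-unique xs! zero    = All.[] AllPairs.∷ AllPairs.[]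
vectors-unique xs! (suc n) =
  Unique.cartesianProductWith⁺ _∷_ Vec.∷-injective xs! (vectors-unique xs! n)

vectors-complete : {xs : List A} (v : Vec A n) → (∀ i → lookup v i ∈ˡ xs) → v ∈ˡ vectors xs n
vectors-complete []      _  = here refl
vectors-complete (x ∷ v) ∈xs =
  ∈-cartesianProductWith⁺ _∷_ (∈xs zero) (vectors-complete v (∈xs ∘ suc))

-- ℤ⟨ M ⟩ consists of finite formal sums of integer multiples of monomials
-- in M.  A monomial may occur several times in a list, so polynomials are
-- compared by their coefficients and never by _≡_.

ℤ⟨_⟩ : Set → Set
ℤ⟨ M ⟩ = List (ℤ × M)

sumℤ : List ℤ → ℤ
sumℤ = List.foldr ℤ._+_ 0ℤ

coefficient : {M : Set} → DecidableEquality M → ℤ⟨ M ⟩ → M → ℤ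
coefficient _≟_ p u = sumℤ (List.map proj₁ (List.filter (λ t → proj₂ t ≟ u) p))

ℤ[β] : Set
ℤ[β] = ℤ⟨ ℕ ⟩

infix 4 _≈β_ _≈_

_≈β_ : ℤ[β] → ℤ[β] → Set
p ≈β q = ∀ k → coefficient ℕ._≟_ p k ≡ coefficient ℕ._≟_ q k

eval : ℤ[β] → ℤ → ℤ
eval p z = sumℤ (List.map (λ (c , k) → c ℤ.* z ℤ.^ k) p)

-- (k , m) is the monomial β^k x₁^m₁ ⋯ xₙ^mₙ.
Monomial : ℕ → Set
Monomial n = ℕ × Vec ℕ n

Polynomial : ℕ → Set
Polynomial n = ℤ⟨ Monomial n ⟩

_≟ᵐ_ : DecidableEquality (Monomial n)
_≟ᵐ_ = Product.≡-dec ℕ._≟_ (Vec.≡-dec ℕ._≟_)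

_≈_ : Polynomial n → Polynomial n → Set
p ≈ q = ∀ u → coefficient _≟ᵐ_ p u ≡ coefficient _≟ᵐ_ q u

monomial : ℕ → Vec ℕ n → ℤ × Monomial n
monomial k m = 1ℤ , k , m

infixr 7 _·_

_·_ : ℤ[β] → Polynomial n → Polynomial n
_·_ = cartesianProductWith (λ (c , k) (d , l , m) → c ℤ.* d , k + l , m)

WeakComposition : ℕ → Set
WeakComposition n = Vec ℕ n

size : WeakComposition n → ℕ
size a = sum (toList a)

infix 8 _⁺

_⁺ : WeakComposition n → List ℕ
a ⁺ = List.filter (λ x → ¬? (x ℕ.≟ 0)) (toList a)

WeaklyDecreasing : List ℕ → Set
WeaklyDecreasing = Linked _≥_

prefixSum : WeakComposition n → Fin n → ℕ
prefixSum a i = sum (List.take (suc (toℕ i)) (toList a))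

infix 4 _⊵_

_⊵_ : WeakComposition n → WeakComposition n → Set
b ⊵ a = ∀ i → prefixSum b i ≥ prefixSum a i

-- A finitely supported family of elements of ℤ[β].
record Family (n : ℕ) : Set where
  field
    coeff    : WeakComposition n → ℤ[β]
    support  : List (WeakComposition n)
    unique   : Unique support
    vanishes : ∀ b → b ∉ˡ support → coeff b ≈β []

open Family public using (coeff; support)

combination : Family n → (WeakComposition n → Polynomial n) → Polynomial n
combination Q P = concatMap (λ b → coeff Q b · P b) (support Q)

sumAt : ℤ → Family n → ℤ
sumAt z Q = sumℤ (List.map (λ b → eval (coeff Q b) z) (support Q))

-- black k and red k are coloured entries of value 1 + k.
data Entry : Set where
  ∅         : Entry
  black red : ℕ → Entry

value : Entry → ℕ
value ∅         = 0
value (black k) = suc k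
value (red k)   = suc k

redness : Entry → ℕ
redness (red _) = 1
redness _       = 0

WeakKomposition : ℕ → Set
WeakKomposition n = Vec Entry n

ex : List Entry → ℕ
ex B = sum (List.map redness B)

data LeftmostBlack : List Entry → Set where
  here  : ∀ {k B} → LeftmostBlack (black k ∷ B)
  there : ∀ {B} → LeftmostBlack B → LeftmostBlack (∅ ∷ B)

-- The position, counted from 1, of the last nonzero entry; 0 if there is none.
lastNonzero : List ℕ → ℕ
lastNonzero []       = 0
lastNonzero (x ∷ xs) with lastNonzero xs
... | suc k = suc (suc k)
... | zero  with x
...   | zero  = 0
...   | suc _ = 1

-- Let n_1 < n_2 < … be the positions, counted from 1, of the nonzero entries of
-- a, and n_0 = 0.  If 1 + toℕ p = n_j, this is (b_{n_{j-1}+1}, …, b_{n_j}).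
block : WeakComposition n → WeakKomposition n → Fin n → List Entry
block a b p =
  List.drop (lastNonzero (List.take (toℕ p) (toList a))) (List.take (suc (toℕ p)) (toList b))

record MesonicBlock (k : ℕ) (B : List Entry) (end : Entry) : Set where
  field
    weight   : k + ex B ≡ sum (List.map value B)
    leftmost : LeftmostBlack B
    nonzero  : end ≢ ∅

record MesonicGlide (a : WeakComposition n) (b : WeakKomposition n) : Set where
  field
    trailing : ∀ i → lastNonzero (toList a) ≤ toℕ i → lookup b i ≡ ∅
    blocks   : ∀ p → lookup a p ≢ 0 → MesonicBlock (lookup a p) (block a b p) (lookup b p)

_≟ᵉ_ : DecidableEquality Entry
∅       ≟ᵉ ∅       = yes refl
∅       ≟ᵉ black _ = no λ ()
∅       ≟ᵉ red _   = no λ ()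
black _ ≟ᵉ ∅       = no λ ()
black k ≟ᵉ black l = map′ (cong black) (λ { refl → refl }) (k ℕ.≟ l)
black _ ≟ᵉ red _   = no λ ()
red _   ≟ᵉ ∅       = no λ ()
red _   ≟ᵉ black _ = no λ ()
red k   ≟ᵉ red l   = map′ (cong red) (λ { refl → refl }) (k ℕ.≟ l)

leftmostBlack? : Decidable LeftmostBlack
leftmostBlack? []            = no λ ()
leftmostBlack? (∅ ∷ B)       = map′ there (λ { (there h) → h }) (leftmostBlack? B)
leftmostBlack? (black k ∷ B) = yes here
leftmostBlack? (red k ∷ B)   = no λ ()

mesonicBlock? : ∀ k B e → Dec (MesonicBlock k B e)
mesonicBlock? k B e = map′
  (λ (w , l , z) → record { weight = w ; leftmost = l ; nonzero = z })
  (λ M → let open MesonicBlock M in weight , leftmost , nonzero)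
  (k + ex B ℕ.≟ sum (List.map value B) ×-dec leftmostBlack? B ×-dec ¬? (e ≟ᵉ ∅))

mesonicGlide? : (a : WeakComposition n) → Decidable (MesonicGlide a)
mesonicGlide? a b = map′
  (λ (t , c) → record { trailing = t ; blocks = c })
  (λ M → let open MesonicGlide M in trailing , blocks)
  (Fin.all? (λ i → (lastNonzero (toList a) ℕ.≤? toℕ i) →-dec (lookup b i ≟ᵉ ∅))
   ×-dec Fin.all? (λ p → ¬? (lookup a p ℕ.≟ 0) →-dec mesonicBlock? _ _ _))

entriesUpTo : ℕ → List Entry
entriesUpTo N = ∅ ∷ List.map black (List.upTo N) ++ List.map red (List.upTo N)

entriesUpTo-unique : ∀ N → Unique (entriesUpTo N)
entriesUpTo-unique N =
  All.tabulate (λ { e∈ refl → ∅∉ e∈ })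
  AllPairs.∷ Unique.++⁺ (Unique.map⁺ (λ { refl → refl }) (Unique.upTo⁺ N))
                        (Unique.map⁺ (λ { refl → refl }) (Unique.upTo⁺ N))
                        (λ (e∈b , e∈r) → disjoint (∈-map⁻ black e∈b) (∈-map⁻ red e∈r))
  where
  disjoint : ∀ {e} → (∃ λ k → k ∈ˡ List.upTo N × e ≡ black k) →
             ¬ (∃ λ k → k ∈ˡ List.upTo N × e ≡ red k)
  disjoint (_ , _ , refl) (_ , _ , ())
  ∅∉′ : ∀ xs ys → ∅ ∉ˡ List.map black xs ++ List.map red ys
  ∅∉′ []       (_ ∷ ys) (there h) = ∅∉′ [] ys h
  ∅∉′ (_ ∷ xs) ys       (there h) = ∅∉′ xs ys h
  ∅∉ : ∅ ∉ˡ List.map black (List.upTo N) ++ List.map red (List.upTo N)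
  ∅∉ = ∅∉′ (List.upTo N) (List.upTo N)

entriesUpTo-complete : ∀ {N} e → value e ≤ N → e ∈ˡ entriesUpTo N
entriesUpTo-complete ∅         _   = here refl
entriesUpTo-complete (black k) k<N = there (∈-++⁺ˡ (∈-map⁺ black (∈-upTo⁺ k<N)))
entriesUpTo-complete (red k)   k<N = there (∈-++⁺ʳ _ (∈-map⁺ red (∈-upTo⁺ k<N)))

∈⇒≤sum : ∀ {x xs} → x ∈ˡ xs → x ≤ sum xs
∈⇒≤sum (here refl) = ℕ.m≤m+n _ _
∈⇒≤sum (there x∈)  = ℕ.≤-trans (∈⇒≤sum x∈) (ℕ.m≤n+m _ _)

lookup-∈-toList : (v : Vec A n) → ∀ i → lookup v i ∈ˡ toList v
lookup-∈-toList (x ∷ v) zero    = here refl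
lookup-∈-toList (x ∷ v) (suc i) = there (lookup-∈-toList v i)

lookup-∈-slice : (v : Vec A n) (i : Fin n) → ∀ {k l} → k ≤ toℕ i → toℕ i < l →
                 lookup v i ∈ˡ List.drop k (List.take l (toList v))
lookup-∈-slice (x ∷ v) zero    z≤n       (s≤s _)   = here refl
lookup-∈-slice (x ∷ v) (suc i) z≤n       (s≤s i<l) = there (lookup-∈-slice v i z≤n i<l)
lookup-∈-slice (x ∷ v) (suc i) (s≤s k≤i) (s≤s i<l) = lookup-∈-slice v i k≤i i<l

lastNonzero-∷ : ∀ x xs → lastNonzero (x ∷ xs) ≤ suc (lastNonzero xs)
lastNonzero-∷ x xs with lastNonzero xs
... | suc k = ℕ.≤-refl
... | zero  with x
...   | zero  = z≤n
...   | suc _ = ℕ.≤-refl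

lastNonzero-0∷ : ∀ xs → lastNonzero xs ≤ 0 → lastNonzero (0 ∷ xs) ≤ 0
lastNonzero-0∷ xs eq with lastNonzero xs
... | zero = z≤n

InBlock : WeakComposition n → ℕ → Set
InBlock {n} a i = ∃ λ (p : Fin n) →
  lookup a p ≢ 0 × i ≤ toℕ p × lastNonzero (List.take (toℕ p) (toList a)) ≤ i

firstBlock : (a : WeakComposition n) → lastNonzero (toList a) ≤ 0 ⊎ InBlock a 0
firstBlock []          = inj₁ z≤n
firstBlock (suc x ∷ a) = inj₂ (zero , (λ ()) , z≤n , z≤n)
firstBlock (zero ∷ a)  with firstBlock a
... | inj₁ ≤0               = inj₁ (lastNonzero-0∷ (toList a) ≤0)
... | inj₂ (p , ≢0 , _ , ≤0) = inj₂ (suc p , ≢0 , z≤n , lastNonzero-0∷ (List.take (toℕ p) (toList a)) ≤0)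

inSomeBlock : (a : WeakComposition n) (i : Fin n) →
              lastNonzero (toList a) ≤ toℕ i ⊎ InBlock a (toℕ i)
inSomeBlock a@(_ ∷ _) zero    = firstBlock a
inSomeBlock (x ∷ a)   (suc i) with inSomeBlock a i
... | inj₁ ≤i = inj₁ (ℕ.≤-trans (lastNonzero-∷ x (toList a)) (s≤s ≤i))
... | inj₂ (p , ≢0 , i≤p , ≤i) =
  inj₂ (suc p , ≢0 , s≤s i≤p ,
        ℕ.≤-trans (lastNonzero-∷ x (List.take (toℕ p) (toList a))) (s≤s ≤i))

ex≤length : ∀ B → ex B ≤ List.length B
ex≤length []            = z≤n
ex≤length (∅ ∷ B)       = ℕ.m≤n⇒m≤1+n (ex≤length B)
ex≤length (black _ ∷ B) = ℕ.m≤n⇒m≤1+n (ex≤length B)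
ex≤length (red _ ∷ B)   = s≤s (ex≤length B)

length-block : (a : WeakComposition n) (b : WeakKomposition n) (p : Fin n) →
               List.length (block a b p) ≤ n
length-block {n} a b p = begin
  List.length (List.drop k C)  ≡⟨ List.length-drop k C ⟩
  List.length C ∸ k            ≤⟨ ℕ.m∸n≤m _ k ⟩
  List.length C                ≡⟨ List.length-take (suc (toℕ p)) (toList b) ⟩
  _                            ≤⟨ ℕ.m⊓n≤n (suc (toℕ p)) _ ⟩
  List.length (toList b)       ≡⟨ Vec.length-toList b ⟩
  n                            ∎
  where
  open ℕ.≤-Reasoning
  k = lastNonzero (List.take (toℕ p) (toList a))
  C = List.take (suc (toℕ p)) (toList b)

mesonicGlide-bound : {a : WeakComposition n} {b : WeakKomposition n} → MesonicGlide a b →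
                     ∀ i → value (lookup b i) ≤ size a + n
mesonicGlide-bound {n} {a} {b} M i with inSomeBlock a i
... | inj₁ ≤i rewrite MesonicGlide.trailing M i ≤i = z≤n
... | inj₂ (p , ≢0 , i≤p , ≤i) = begin
  value (lookup b i)                   ≤⟨ ∈⇒≤sum (∈-map⁺ value (lookup-∈-slice b i ≤i (s≤s i≤p))) ⟩
  sum (List.map value (block a b p))   ≡⟨ MesonicBlock.weight (MesonicGlide.blocks M p ≢0) ⟨
  lookup a p + ex (block a b p)        ≤⟨ ℕ.+-mono-≤ (∈⇒≤sum (lookup-∈-toList a p))
                                           (ℕ.≤-trans (ex≤length (block a b p)) (length-block a b p)) ⟩
  size a + n                           ∎
  where open ℕ.≤-Reasoning

mesonicGlides : (a : WeakComposition n) → Finite (MesonicGlide a)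
mesonicGlides {n} a = finite-filter (mesonicGlide? a)
  (vectors (entriesUpTo (size a + n)) n)
  (vectors-unique (entriesUpTo-unique (size a + n)) n)
  (λ M → vectors-complete _ (λ i → entriesUpTo-complete _ (mesonicGlide-bound M i)))

kaon : WeakComposition n → Polynomial n
kaon a = List.map (λ b → monomial (ex (toList b)) (Vec.map value b)) (elements (mesonicGlides a))

-- Rows, columns and entries are indexed from 0: element i of Fin n stands for
-- the row or entry i + 1.
record Box (a : WeakComposition n) : Set where
  constructor box
  field
    row : Fin n
    col : Fin (lookup a row)

  column : ℕ
  column = toℕ col

open Box public using (row; column)

-- The entries of a semistandard filling of shape a are at most n: anchors in
-- the leftmost column are row indices and entries weakly decrease along rows.
-- So nothing is lost by filling the boxes with subsets of {1, …, n}.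
Filling : WeakComposition n → Set
Filling {n} a = VecAll.All (Vec (Subset n)) a

_⟦_⟧ : {a : WeakComposition n} → Filling a → Box a → Subset n
T ⟦ box i c ⟧ = lookup (VecAll.lookup⁺ T i) c

contents : {a : WeakComposition n} → VecAll.All (Vec A) a → List A
contents []      = []
contents (R ∷ T) = toList R ++ contents T

Anchor : Subset n → Fin n → Set
Anchor S x = x ∈ S × (∀ y → y ∈ S → y Fin.≤ x)

Free : Subset n → Fin n → Set
Free S x = x ∈ S × ¬ Anchor S x

_≟ᵇ_ : {a : WeakComposition n} → DecidableEquality (Box a)
box i c ≟ᵇ box j d with i Fin.≟ j
... | no i≢j   = no λ { refl → i≢j refl }
... | yes refl = map′ (cong (box i)) (λ { refl → refl }) (c Fin.≟ d)

-- The conditions are stated for functions F : Box a → Subset n so that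
-- FreeEntriesLow can ask whether RowsDecrease survives moving a free entry.
module _ {n : ℕ} {a : WeakComposition n} where

  SameColumn : Box a → Box a → Set
  SameColumn p q = column p ≡ column q

  ImmediatelyRightOf : Box a → Box a → Set
  ImmediatelyRightOf q p = row q ≡ row p × column q ≡ suc (column p)

  move : Fin n → Box a → Box a → (Box a → Subset n) → (Box a → Subset n)
  move x p q F r with r ≟ᵇ q | r ≟ᵇ p
  ... | yes _ | _     = F r ∪ ⁅ x ⁆
  ... | no _  | yes _ = F r - x
  ... | no _  | no _  = F r

  ColumnsDistinct : (Box a → Subset n) → Set
  ColumnsDistinct F = ∀ p q → SameColumn p q → p ≢ q → ∀ x → x ∈ F p → x ∉ F q

  RowsDecrease : (Box a → Subset n) → Set
  RowsDecrease F = ∀ p q → ImmediatelyRightOf q p → ∀ x y → x ∈ F p → y ∈ F q → y Fin.≤ x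

  RowAtLeast : Fin n → Fin n → Set
  RowAtLeast i j = (i Fin.< j × lookup a j ≤ lookup a i) ⊎ (j Fin.< i × lookup a j < lookup a i)

  -- p, q and r are the boxes of α, β and γ.
  TripleCondition : (Box a → Subset n) → Set
  TripleCondition F = ∀ p q r → ImmediatelyRightOf p q → RowAtLeast (row p) (row r) →
    (row p Fin.< row r × SameColumn r p) ⊎ (row r Fin.< row q × SameColumn r q) →
    ∀ α β γ → Anchor (F p) α → Anchor (F q) β → Anchor (F r) γ → γ Fin.< α ⊎ β Fin.< γ

  -- An entry x is free in the box q only if it is smaller than the anchor of q,
  -- so only such boxes compete for x.
  FreeEntriesLow : (Box a → Subset n) → Set
  FreeEntriesLow F = ∀ p q → SameColumn p q → ∀ x α α′ →
    Free (F p) x → Anchor (F p) α → Anchor (F q) α′ →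
    x Fin.< α′ → α′ Fin.< α → ¬ RowsDecrease (move x p q F)

  LeftmostAnchors : (Box a → Subset n) → Set
  LeftmostAnchors F = ∀ p → column p ≡ 0 → Anchor (F p) (row p)

  record Semistandard (F : Box a → Subset n) : Set where
    field
      nonempty        : ∀ p → Nonempty (F p)
      columnsDistinct : ColumnsDistinct F
      rowsDecrease    : RowsDecrease F
      tripleCondition : TripleCondition F
      freeEntriesLow  : FreeEntriesLow F
      leftmostAnchors : LeftmostAnchors F

weight : {a : WeakComposition n} → Filling a → WeakComposition n
weight T = tabulate (λ i → List.length (List.filter (i ∈?_) (contents T)))

excess : {a : WeakComposition n} → Filling a → ℕ
excess {a = a} T = sum (List.map ∣_∣ (contents T)) ∸ size a

anchor? : (S : Subset n) → Decidable (Anchor S)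
anchor? S x = (x ∈? S) ×-dec Fin.all? (λ y → (y ∈? S) →-dec (y Fin.≤? x))

free? : (S : Subset n) → Decidable (Free S)
free? S x = (x ∈? S) ×-dec ¬? (anchor? S x)

module _ {n : ℕ} {a : WeakComposition n} where

  allBoxes? : {P : Box a → Set} → Decidable P → Dec (∀ p → P p)
  allBoxes? P? = map′ (λ { f (box i c) → f i c }) (λ f i c → f (box i c))
    (Fin.all? λ i → Fin.all? λ c → P? (box i c))

  sameColumn? : (p q : Box a) → Dec (SameColumn p q)
  sameColumn? p q = column p ℕ.≟ column q

  rightOf? : (q p : Box a) → Dec (ImmediatelyRightOf q p)
  rightOf? q p = (row q Fin.≟ row p) ×-dec (column q ℕ.≟ suc (column p))

  columnsDistinct? : Decidable (ColumnsDistinct {a = a})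
  columnsDistinct? F = allBoxes? λ p → allBoxes? λ q → sameColumn? p q →-dec
    ¬? (p ≟ᵇ q) →-dec Fin.all? λ x → (x ∈? F p) →-dec ¬? (x ∈? F q)

  rowsDecrease? : Decidable (RowsDecrease {a = a})
  rowsDecrease? F = allBoxes? λ p → allBoxes? λ q → rightOf? q p →-dec
    Fin.all? λ x → Fin.all? λ y → (x ∈? F p) →-dec (y ∈? F q) →-dec (y Fin.≤? x)

  rowAtLeast? : ∀ i j → Dec (RowAtLeast {a = a} i j)
  rowAtLeast? i j = ((i Fin.<? j) ×-dec (lookup a j ℕ.≤? lookup a i))
    ⊎-dec ((j Fin.<? i) ×-dec (lookup a j ℕ.<? lookup a i))

  tripleCondition? : Decidable (TripleCondition {a = a})
  tripleCondition? F = allBoxes? λ p → allBoxes? λ q → allBoxes? λ r →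
    rightOf? p q →-dec rowAtLeast? (row p) (row r) →-dec
    (((row p Fin.<? row r) ×-dec sameColumn? r p)
      ⊎-dec ((row r Fin.<? row q) ×-dec sameColumn? r q)) →-dec
    Fin.all? λ α → Fin.all? λ β → Fin.all? λ γ →
    anchor? (F p) α →-dec anchor? (F q) β →-dec anchor? (F r) γ →-dec
    ((γ Fin.<? α) ⊎-dec (β Fin.<? γ))

  freeEntriesLow? : Decidable (FreeEntriesLow {a = a})
  freeEntriesLow? F = allBoxes? λ p → allBoxes? λ q → sameColumn? p q →-dec
    Fin.all? λ x → Fin.all? λ α → Fin.all? λ α′ →
    free? (F p) x →-dec anchor? (F p) α →-dec anchor? (F q) α′ →-dec
    (x Fin.<? α′) →-dec (α′ Fin.<? α) →-dec ¬? (rowsDecrease? (move x p q F))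

  leftmostAnchors? : Decidable (LeftmostAnchors {a = a})
  leftmostAnchors? F = allBoxes? λ p → (column p ℕ.≟ 0) →-dec anchor? (F p) (row p)

  semistandard? : Decidable (Semistandard {a = a})
  semistandard? F = map′
    (λ (e , s1 , s2 , s3 , s4 , s5) → record
      { nonempty        = e  ; columnsDistinct = s1 ; rowsDecrease    = s2
      ; tripleCondition = s3 ; freeEntriesLow  = s4 ; leftmostAnchors = s5 })
    (λ S → let open Semistandard S in
      nonempty , columnsDistinct , rowsDecrease , tripleCondition , freeEntriesLow , leftmostAnchors)
    (allBoxes? (λ p → nonempty? (F p)) ×-dec columnsDistinct? F ×-dec rowsDecrease? F
      ×-dec tripleCondition? F ×-dec freeEntriesLow? F ×-dec leftmostAnchors? F)

arrays : List A → (a : Vec ℕ m) → List (VecAll.All (Vec A) a)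
arrays xs []      = [] ∷ []
arrays xs (k ∷ a) = cartesianProductWith _∷_ (vectors xs k) (arrays xs a)

arrays-unique : {xs : List A} → Unique xs → (a : Vec ℕ m) → Unique (arrays xs a)
arrays-unique xs! []      = All.[] AllPairs.∷ AllPairs.[]
arrays-unique xs! (k ∷ a) = Unique.cartesianProductWith⁺ _∷_ (λ { refl → refl , refl })
  (vectors-unique xs! k) (arrays-unique xs! a)

arrays-complete : {xs : List A} → (∀ x → x ∈ˡ xs) →
                  {a : Vec ℕ m} (T : VecAll.All (Vec A) a) → T ∈ˡ arrays xs a
arrays-complete ∈xs []      = here refl
arrays-complete ∈xs (R ∷ T) =
  ∈-cartesianProductWith⁺ _∷_ (vectors-complete R (λ i → ∈xs _)) (arrays-complete ∈xs T)

subsets : ∀ n → List (Subset n)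
subsets = vectors (false ∷ true ∷ [])

subsets-unique : ∀ n → Unique (subsets n)
subsets-unique = vectors-unique
  (((λ ()) All.∷ All.[]) AllPairs.∷ All.[] AllPairs.∷ AllPairs.[])

subsets-complete : (S : Subset n) → S ∈ˡ subsets n
subsets-complete S = vectors-complete S (λ i → bool (lookup S i))
  where
  bool : ∀ b → b ∈ˡ false ∷ true ∷ []
  bool false = here refl
  bool true  = there (here refl)

𝔄SSF : (a : WeakComposition n) → Finite (λ (T : Filling a) → Semistandard (T ⟦_⟧))
𝔄SSF {n} a = finite-filter (λ T → semistandard? (T ⟦_⟧))
  (arrays (subsets n) a)
  (arrays-unique (subsets-unique n) a)
  (λ {T} _ → arrays-complete subsets-complete T)

lascouxAtom : WeakComposition n → Polynomial n
lascouxAtom a = List.map (λ T → monomial (excess T) (weight T)) (elements (𝔄SSF a))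

Slide : WeakComposition n → WeakComposition n → Set
Slide a b = b ⊵ a × b ⁺ ≡ a ⁺

slide? : (a : WeakComposition n) → Decidable (Slide a)
slide? a b = Fin.all? (λ i → prefixSum a i ℕ.≤? prefixSum b i)
  ×-dec List.≡-dec ℕ._≟_ (b ⁺) (a ⁺)

slide-bound : {a b : WeakComposition n} → Slide a b → ∀ i → lookup b i ≤ size a
slide-bound {a = a} {b} (_ , b⁺≡a⁺) i with lookup b i ℕ.≟ 0
... | yes bᵢ≡0 rewrite bᵢ≡0 = z≤n
... | no  bᵢ≢0 = ∈⇒≤sum (proj₁ (∈-filter⁻ (λ x → ¬? (x ℕ.≟ 0)) {xs = toList a}
  (subst (lookup b i ∈ˡ_) b⁺≡a⁺ (∈-filter⁺ (λ x → ¬? (x ℕ.≟ 0)) (lookup-∈-toList b i) bᵢ≢0))))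

slides : (a : WeakComposition n) → Finite (Slide a)
slides {n} a = finite-filter (slide? a)
  (vectors (List.upTo (suc (size a))) n)
  (vectors-unique (Unique.upTo⁺ _) n)
  (λ {b} s → vectors-complete b (λ i → ∈-upTo⁺ (s≤s (slide-bound {a = a} {b = b} s i))))

glide : WeakComposition n → Polynomial n
glide a = concatMap kaon (elements (slides a))

quasiLascoux : WeakComposition n → Polynomial n
quasiLascoux a = concatMap lascouxAtom (elements (slides a))

{-# OPTIONS --safe #-}
-- Set β = -1 and let ε_S be the functional sending xᵐ to 1 if the support of m
-- lies in S ⊆ {1, …, n}, and to 0 otherwise.  Sign-reversing involutions give
--   ε_S(kaon a) = 1 if the support of a is S ∩ {1, …, last nonzero position of a},
--                 0 otherwise;
--   ε_S(atom a) = ε_S(kaon a) if a⁺ is weakly decreasing, 0 otherwise.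
-- For atoms the involution adds or removes a free entry in S; a filling without
-- any place for one has all entries of row i equal to i, and its shape weakly
-- decreases along S.  For kaons it splits off a new black entry at the first
-- element of S that is missing in the support of a.
-- A suitable combination of the ε_S is 1 on every kaon, and ε_{1, …, n} is 1 on
-- every glide polynomial, since exactly one slide is left-justified.  Applying
-- these functionals to the two expansions gives the coefficient sums.
module Submission where

-- No single ε_S suffices for kaons: even ε_{1, ..., n} vanishes on every kaon whose index has a
-- zero before a nonzero part, so all subsets have to be combined. The expansions themselves are
-- never computed. What matters is that an atom and the kaon with the same index agree under every
-- ε_S up to a factor independent of S; any functional that is 1 on all kaons then reads off that
-- factor as the coefficient sum. For fillings, the delicate point is to choose the free entry to be
-- toggled in a way that the toggle itself does not disturb. Whether an entry may be added or
-- removed somewhere is therefore expressed through the anchors alone. A toggle keeps all anchors,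
-- so the filling and its image offer the same list of places, and taking the first of them gives an
-- involution.

open import Defs
open import Data.Bool.Base using (true; false; not)
import Data.Bool.Properties as Bool
open import Data.Empty using (⊥; ⊥-elim)
open import Data.Fin.Base as Fin using (Fin; zero; suc; toℕ; fromℕ<)
import Data.Fin.Induction as Fin
import Data.Fin.Properties as Fin
open import Data.Fin.Subset as Subset using (Subset; Nonempty; ∣_∣; ⁅_⁆; _∈_; ⊤)
open import Data.Fin.Subset.Properties
  using (_∈?_; drop-there; nonempty?; x∈⁅x⁆; x∈⁅y⁆⇒x≡y; x∈p∪q⁻; x∈p∪q⁺; p─q⊆p; ∣⁅x⁆∣≡1;
         ⊆-antisym; ∉⊥; Empty-unique)
open import Data.Integer.Base as ℤ using (ℤ; 0ℤ; 1ℤ; -1ℤ)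
import Data.Integer.Properties as ℤ
open import Data.Integer.Tactic.RingSolver using (solve-∀)
open import Data.List.Base as List
  using (List; []; _∷_; _++_; _∷ʳ_; concatMap; cartesianProductWith)
import Data.List.Properties as List
open import Data.List.Membership.Propositional using () renaming (_∈_ to _∈ˡ_)
import Data.List.Membership.Propositional.Properties as ∈ˡ
open import Data.List.Membership.Propositional.Properties.WithK using (unique∧set⇒bag)
open import Data.List.Relation.Binary.BagAndSetEquality using (∼bag⇒↭)
open import Data.List.Relation.Binary.Permutation.Propositional as ↭ using (_↭_)
open import Data.List.Relation.Unary.All as All using (All; []; _∷_)
import Data.List.Relation.Unary.All.Properties as All
open import Data.List.Relation.Unary.AllPairs as AllPairs using ()
open import Data.List.Relation.Unary.Any using (here; there)
open import Data.List.Relation.Unary.Linked as Linked using ([]; [-]; _∷_)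
import Data.List.Relation.Unary.Linked.Properties as Linked
import Data.List.Relation.Unary.Unique.DecPropositional.Properties as UniqueDec
open import Data.List.Relation.Unary.Unique.Propositional using (Unique)
import Data.List.Relation.Unary.Unique.Propositional.Properties as Unique
open import Data.Maybe.Base using (Maybe; just; nothing)
open import Data.Nat.Base as ℕ using (ℕ; zero; suc; _+_; _∸_; _≤_; _<_; _≥_; z≤n; s≤s)
open import Data.Nat.ListAction using (sum)
open import Data.Nat.ListAction.Properties using (sum-++)
import Data.Nat.Properties as ℕ
import Data.Nat.Tactic.RingSolver as ℕ-Solver
open import Data.Product.Base using (∃; ∃₂; _×_; _,_; proj₁; proj₂; uncurry)
open import Data.Sum.Base using (_⊎_; inj₁; inj₂)
open import Data.Vec.Base as Vec using (Vec; []; _∷_; lookup; toList)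
import Data.Vec.Properties as Vec
open import Data.Vec.Relation.Unary.All as VecAll using ([]; _∷_)
import Data.Vec.Relation.Unary.All.Properties as VecAll
open import Function.Base using (_∘_)
open import Function.Bundles using (mk⇔)
open import Induction.WellFounded using (Acc; acc)
open import Relation.Binary.Definitions using (DecidableEquality)
open import Relation.Binary.PropositionalEquality
  using (_≡_; _≢_; refl; sym; trans; cong; cong₂; subst; subst₂; module ≡-Reasoning)
open import Relation.Nullary.Decidable
  using (Dec; yes; no; ¬?; map′; _×-dec_; _→-dec_; decidable-stable)
open import Relation.Nullary.Negation using (¬_; contradiction)
open import Relation.Unary using (Decidable)

open ≡-Reasoning

private
  variable
    A C D P P′ : Set
    m n : ℕ
    k w w′ : ℕ
    σ : Maybe ℕ
    e e′ : Entry
    a : WeakComposition n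
    b b′ : WeakKomposition n
    S : Subset n
    B : List Entry

-- Signed sums and functionals on polynomials

∑ : List A → (A → ℤ) → ℤ
∑ xs f = sumℤ (List.map f xs)

∑-cong : (xs : List A) {f g : A → ℤ} → (∀ {x} → x ∈ˡ xs → f x ≡ g x) → ∑ xs f ≡ ∑ xs g
∑-cong []       eq = refl
∑-cong (x ∷ xs) eq = cong₂ ℤ._+_ (eq (here refl)) (∑-cong xs (eq ∘ there))

∑-zero : (xs : List A) {f : A → ℤ} → (∀ {x} → x ∈ˡ xs → f x ≡ 0ℤ) → ∑ xs f ≡ 0ℤ
∑-zero []       eq = refl
∑-zero (x ∷ xs) eq = cong₂ ℤ._+_ (eq (here refl)) (∑-zero xs (eq ∘ there))

∑-++ : (xs ys : List A) (f : A → ℤ) → ∑ (xs ++ ys) f ≡ ∑ xs f ℤ.+ ∑ ys f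
∑-++ []       ys f = sym (ℤ.+-identityˡ _)
∑-++ (x ∷ xs) ys f = trans (cong (λ s → f x ℤ.+ s) (∑-++ xs ys f)) (sym (ℤ.+-assoc (f x) _ _))

∑-map : (h : A → C) (xs : List A) (f : C → ℤ) → ∑ (List.map h xs) f ≡ ∑ xs (f ∘ h)
∑-map h xs f = cong sumℤ (sym (List.map-∘ xs))

∑-concatMap : (h : A → List C) (xs : List A) (f : C → ℤ) →
              ∑ (concatMap h xs) f ≡ ∑ xs (λ x → ∑ (h x) f)
∑-concatMap h []       f = refl
∑-concatMap h (x ∷ xs) f =
  trans (∑-++ (h x) (concatMap h xs) f) (cong (λ s → ∑ (h x) f ℤ.+ s) (∑-concatMap h xs f))

∑-cartesianProductWith : (h : A → C → D) (xs : List A) (ys : List C) (f : D → ℤ) →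
  ∑ (cartesianProductWith h xs ys) f ≡ ∑ xs (λ x → ∑ ys (f ∘ h x))
∑-cartesianProductWith h []       ys f = refl
∑-cartesianProductWith h (x ∷ xs) ys f =
  trans (∑-++ (List.map (h x) ys) (cartesianProductWith h xs ys) f)
        (cong₂ ℤ._+_ (∑-map (h x) ys f) (∑-cartesianProductWith h xs ys f))

∑-+ : (xs : List A) (f g : A → ℤ) → ∑ xs (λ x → f x ℤ.+ g x) ≡ ∑ xs f ℤ.+ ∑ xs g
∑-+ []       f g = refl
∑-+ (x ∷ xs) f g =
  trans (cong (λ s → f x ℤ.+ g x ℤ.+ s) (∑-+ xs f g)) (lemma (f x) (g x) _ _)
  where
  lemma : ∀ a b c d → a ℤ.+ b ℤ.+ (c ℤ.+ d) ≡ a ℤ.+ c ℤ.+ (b ℤ.+ d)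
  lemma = solve-∀

∑-*ˡ : (xs : List A) (c : ℤ) (f : A → ℤ) → ∑ xs (λ x → c ℤ.* f x) ≡ c ℤ.* ∑ xs f
∑-*ˡ []       c f = sym (ℤ.*-zeroʳ c)
∑-*ˡ (x ∷ xs) c f =
  trans (cong (λ s → c ℤ.* f x ℤ.+ s) (∑-*ˡ xs c f)) (sym (ℤ.*-distribˡ-+ c (f x) _))

∑-*ʳ : (xs : List A) (c : ℤ) (f : A → ℤ) → ∑ xs (λ x → f x ℤ.* c) ≡ ∑ xs f ℤ.* c
∑-*ʳ xs c f = trans (∑-cong xs (λ {x} _ → ℤ.*-comm (f x) c))
                    (trans (∑-*ˡ xs c f) (ℤ.*-comm c _))

∑-swap : (xs : List A) (ys : List C) (f : A → C → ℤ) →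
         ∑ xs (λ x → ∑ ys (f x)) ≡ ∑ ys (λ y → ∑ xs (λ x → f x y))
∑-swap []       ys f = sym (∑-zero ys (λ _ → refl))
∑-swap (x ∷ xs) ys f =
  trans (cong (λ s → ∑ ys (f x) ℤ.+ s) (∑-swap xs ys f)) (sym (∑-+ ys (f x) _))

∑-filter : {Q : A → Set} (Q? : Decidable Q) (xs : List A) (f : A → ℤ) →
  ∑ xs f ≡ ∑ (List.filter Q? xs) f ℤ.+ ∑ (List.filter (¬? ∘ Q?) xs) f
∑-filter Q? []       f = refl
∑-filter Q? (x ∷ xs) f with Q? x | ∑-filter Q? xs f
... | yes _ | ih = trans (cong (λ s → f x ℤ.+ s) ih)
  (sym (ℤ.+-assoc (f x) (∑ (List.filter Q? xs) f) (∑ (List.filter (¬? ∘ Q?) xs) f)))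
... | no  _ | ih = trans (cong (λ s → f x ℤ.+ s) ih)
  (lemma (f x) (∑ (List.filter Q? xs) f) (∑ (List.filter (¬? ∘ Q?) xs) f))
  where
  lemma : ∀ a b c → a ℤ.+ (b ℤ.+ c) ≡ b ℤ.+ (a ℤ.+ c)
  lemma = solve-∀

∑-single : {xs : List A} (f : A → ℤ) → Unique xs → ∀ {x₀} → x₀ ∈ˡ xs →
           (∀ {x} → x ∈ˡ xs → x ≢ x₀ → f x ≡ 0ℤ) → ∑ xs f ≡ f x₀
∑-single {xs = x ∷ xs} f (x∉ AllPairs.∷ xs!) (here refl) zeros =
  trans (cong (λ s → f x ℤ.+ s)
              (∑-zero xs (λ y∈ → zeros (there y∈) (λ { refl → All.lookup x∉ y∈ refl }))))
        (ℤ.+-identityʳ (f x))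
∑-single {xs = x ∷ xs} f (x∉ AllPairs.∷ xs!) (there x₀∈) zeros =
  trans (cong₂ ℤ._+_ (zeros (here refl) (λ { refl → All.lookup x∉ x₀∈ refl }))
                     (∑-single f xs! x₀∈ (zeros ∘ there)))
        (ℤ.+-identityˡ _)

∑-↭ : {xs ys : List A} (f : A → ℤ) → xs ↭ ys → ∑ xs f ≡ ∑ ys f
∑-↭ f ↭.refl          = refl
∑-↭ f (↭.prep x p)    = cong (λ s → f x ℤ.+ s) (∑-↭ f p)
∑-↭ f (↭.swap x y p)  = trans (cong (λ s → f x ℤ.+ (f y ℤ.+ s)) (∑-↭ f p)) (lemma (f x) (f y) _)
  where
  lemma : ∀ a b c → a ℤ.+ (b ℤ.+ c) ≡ b ℤ.+ (a ℤ.+ c)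
  lemma = solve-∀
∑-↭ f (↭.trans p q)   = trans (∑-↭ f p) (∑-↭ f q)

i≡-i⇒i≡0 : ∀ i → i ≡ ℤ.- i → i ≡ 0ℤ
i≡-i⇒i≡0 (ℤ.+ zero)  eq = refl
i≡-i⇒i≡0 (ℤ.+ suc _) ()
i≡-i⇒i≡0 ℤ.-[1+ _ ]  ()

neg-∑ : (xs : List A) (f : A → ℤ) → ∑ xs (ℤ.-_ ∘ f) ≡ ℤ.- ∑ xs f
neg-∑ []       f = refl
neg-∑ (x ∷ xs) f = trans (cong (λ s → ℤ.- f x ℤ.+ s) (neg-∑ xs f)) (sym (ℤ.neg-distrib-+ (f x) _))

-- Reindexing along `ι` turns the sum into its own negative, and ℤ has no 2-torsion. Fixed points
-- are covered as well: there `f x ≡ - f x` forces the term to be 0.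
∑-involution : {xs : List A} (f : A → ℤ) (ι : A → A) → Unique xs →
               (∀ {x} → x ∈ˡ xs → ι x ∈ˡ xs × ι (ι x) ≡ x × f (ι x) ≡ ℤ.- f x) →
               ∑ xs f ≡ 0ℤ
∑-involution {xs = xs} f ι xs! h = i≡-i⇒i≡0 _ (begin
  ∑ xs f                 ≡⟨ ∑-↭ f permutes ⟩
  ∑ (List.map ι xs) f    ≡⟨ ∑-map ι xs f ⟩
  ∑ xs (f ∘ ι)           ≡⟨ ∑-cong xs (λ x∈ → proj₂ (proj₂ (h x∈))) ⟩
  ∑ xs (ℤ.-_ ∘ f)        ≡⟨ neg-∑ xs f ⟩
  ℤ.- ∑ xs f             ∎)
  where
  ιxs! : ∀ ys → (∀ {x} → x ∈ˡ ys → ι (ι x) ≡ x) → Unique ys → Unique (List.map ι ys)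
  ιxs! []       inv _                  = AllPairs.[]
  ιxs! (y ∷ ys) inv (y∉ AllPairs.∷ ys!) =
    All.tabulate (λ {z} z∈ ιy≡z → let (w , w∈ , z≡ιw) = ∈ˡ.∈-map⁻ ι z∈ in
      All.lookup y∉ w∈ (trans (sym (inv (here refl)))
        (trans (cong ι (trans ιy≡z z≡ιw)) (inv (there w∈)))))
    AllPairs.∷ ιxs! ys (inv ∘ there) ys!
  permutes : xs ↭ List.map ι xs
  -- Both lists are free of duplicates, so having the same elements makes them permutations of each
  -- other.
  permutes = ∼bag⇒↭ (unique∧set⇒bag xs! (ιxs! xs (λ x∈ → proj₁ (proj₂ (h x∈))) xs!)
    (mk⇔ (λ x∈ → let (ιx∈ , ιιx≡x , _) = h x∈ in
                  subst (_∈ˡ List.map ι xs) ιιx≡x (∈ˡ.∈-map⁺ ι ιx∈))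
         (λ z∈ → let (w , w∈ , z≡ιw) = ∈ˡ.∈-map⁻ ι z∈ in
                  subst (_∈ˡ xs) (sym z≡ιw) (proj₁ (h w∈)))))

𝟙 : Dec P → ℤ
𝟙 (yes _) = 1ℤ
𝟙 (no  _) = 0ℤ

𝟙-yes : (d : Dec P) → P → 𝟙 d ≡ 1ℤ
𝟙-yes (yes _) p = refl
𝟙-yes (no ¬p) p = contradiction p ¬p

𝟙-no : (d : Dec P) → ¬ P → 𝟙 d ≡ 0ℤ
𝟙-no (yes p) ¬p = contradiction p ¬p
𝟙-no (no _)  ¬p = refl

𝟙-cong : (d : Dec P) (d′ : Dec P′) → (P → P′) → (P′ → P) → 𝟙 d ≡ 𝟙 d′
𝟙-cong (yes p) d′ f g = sym (𝟙-yes d′ (f p))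
𝟙-cong (no ¬p) d′ f g = sym (𝟙-no d′ (¬p ∘ g))

pairing : {M : Set} → (M → ℤ) → ℤ⟨ M ⟩ → ℤ
pairing f p = ∑ p (λ (c , u) → c ℤ.* f u)

module _ {M : Set} (_≟_ : DecidableEquality M) where

  coefficient-∑ : (p : ℤ⟨ M ⟩) (u : M) →
                  coefficient _≟_ p u ≡ ∑ p (λ (c , v) → c ℤ.* 𝟙 (v ≟ u))
  coefficient-∑ []            u = refl
  coefficient-∑ ((c , v) ∷ p) u with v ≟ u
  ... | yes _ = cong₂ ℤ._+_ (sym (ℤ.*-identityʳ c)) (coefficient-∑ p u)
  ... | no  _ = trans (coefficient-∑ p u)
                  (sym (trans (cong (ℤ._+ _) (ℤ.*-zeroʳ c)) (ℤ.+-identityˡ _)))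

  -- Groups terms by monomial: each term of `p` is spread over `U` by the indicator of its monomial,
  -- and exchanging the sums produces the coefficients. This makes functionals well defined on
  -- formal sums that are compared only through coefficients.
  pairing-coefficient : (f : M → ℤ) (p : ℤ⟨ M ⟩) {U : List M} → Unique U →
    (∀ {t} → t ∈ˡ p → proj₂ t ∈ˡ U) → pairing f p ≡ ∑ U (λ u → coefficient _≟_ p u ℤ.* f u)
  pairing-coefficient f p {U} U! p⊆U = begin
    pairing f p
      ≡⟨ ∑-cong p (λ {t} t∈ → sym (trans
           (∑-single _ U! (p⊆U t∈) (λ {u} _ u≢v →
              trans (cong (λ z → proj₁ t ℤ.* z ℤ.* f u) (𝟙-no (proj₂ t ≟ u) (u≢v ∘ sym)))
                    (trans (cong (ℤ._* f u) (ℤ.*-zeroʳ (proj₁ t))) (ℤ.*-zeroˡ (f u)))))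
           (trans (cong (λ z → proj₁ t ℤ.* z ℤ.* f (proj₂ t)) (𝟙-yes (proj₂ t ≟ proj₂ t) refl))
                  (cong (ℤ._* f (proj₂ t)) (ℤ.*-identityʳ (proj₁ t)))))) ⟩
    ∑ p (λ (c , v) → ∑ U (λ u → c ℤ.* 𝟙 (v ≟ u) ℤ.* f u))
      ≡⟨ ∑-swap p U _ ⟩
    ∑ U (λ u → ∑ p (λ (c , v) → c ℤ.* 𝟙 (v ≟ u) ℤ.* f u))
      ≡⟨ ∑-cong U (λ {u} _ → trans (∑-*ʳ p (f u) _)
           (cong (ℤ._* f u) (sym (coefficient-∑ p u)))) ⟩
    ∑ U (λ u → coefficient _≟_ p u ℤ.* f u) ∎

  pairing-cong : (f : M → ℤ) (p q : ℤ⟨ M ⟩) →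
    (∀ u → coefficient _≟_ p u ≡ coefficient _≟_ q u) → pairing f p ≡ pairing f q
  pairing-cong f p q eq = begin
    pairing f p                              ≡⟨ pairing-coefficient f p U! (in-U ∘ ∈ˡ.∈-++⁺ˡ) ⟩
    ∑ U (λ u → coefficient _≟_ p u ℤ.* f u)  ≡⟨ ∑-cong U (λ {u} _ → cong (ℤ._* f u) (eq u)) ⟩
    ∑ U (λ u → coefficient _≟_ q u ℤ.* f u)  ≡⟨ pairing-coefficient f q U! (in-U ∘ ∈ˡ.∈-++⁺ʳ p) ⟨
    pairing f q                              ∎
    where
    -- One list of monomials for both `p` and `q`, so that the two expansions agree term by term.
    U = List.deduplicate _≟_ (List.map proj₂ (p ++ q))
    U! : Unique U
    U! = UniqueDec.deduplicate-! _≟_ _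
    in-U : ∀ {t} → t ∈ˡ p ++ q → proj₂ t ∈ˡ U
    in-U t∈ = ∈ˡ.∈-deduplicate⁺ _≟_ (∈ˡ.∈-map⁺ proj₂ t∈)

-- The value at β = -1 of the ℤ[β]-linear functional xᵐ ↦ w m.
evaluate : ∀ {n} → (WeakComposition n → ℤ) → Polynomial n → ℤ
evaluate w = pairing (λ (k , m) → -1ℤ ℤ.^ k ℤ.* w m)

module _ {n : ℕ} (w : WeakComposition n → ℤ) where

  evaluate-cong : (p q : Polynomial n) → p ≈ q → evaluate w p ≡ evaluate w q
  evaluate-cong = pairing-cong _≟ᵐ_ _

  evaluate-· : (q : ℤ[β]) (p : Polynomial n) → evaluate w (q · p) ≡ eval q -1ℤ ℤ.* evaluate w p
  evaluate-· q p = begin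
    evaluate w (q · p)
      ≡⟨ ∑-cartesianProductWith _ q p _ ⟩
    ∑ q (λ (c , k) → ∑ p (λ (d , l , m) → c ℤ.* d ℤ.* (-1ℤ ℤ.^ (k ℕ.+ l) ℤ.* w m)))
      ≡⟨ ∑-cong q (λ {(c , k)} _ → trans
           (∑-cong p (λ {(d , l , m)} _ →
             trans (cong (λ s → c ℤ.* d ℤ.* (s ℤ.* w m)) (ℤ.^-distribˡ-+-* -1ℤ k l))
                   (lemma c d (-1ℤ ℤ.^ k) (-1ℤ ℤ.^ l) (w m))))
           (∑-*ˡ p (c ℤ.* -1ℤ ℤ.^ k) _)) ⟩
    ∑ q (λ (c , k) → c ℤ.* -1ℤ ℤ.^ k ℤ.* evaluate w p)
      ≡⟨ ∑-*ʳ q (evaluate w p) _ ⟩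
    eval q -1ℤ ℤ.* evaluate w p ∎
    where
    lemma : ∀ c d s t v → c ℤ.* d ℤ.* (s ℤ.* t ℤ.* v) ≡ c ℤ.* s ℤ.* (d ℤ.* (t ℤ.* v))
    lemma = solve-∀

  evaluate-combination : (Q : Family n) (P : WeakComposition n → Polynomial n) →
    evaluate w (combination Q P) ≡ ∑ (support Q) (λ b → eval (coeff Q b) -1ℤ ℤ.* evaluate w (P b))
  evaluate-combination Q P = trans (∑-concatMap _ (support Q) _)
    (∑-cong (support Q) (λ {b} _ → evaluate-· (coeff Q b) (P b)))

  evaluate-monomials : (e : A → ℕ) (m : A → WeakComposition n) (xs : List A) →
    evaluate w (List.map (λ x → monomial (e x) (m x)) xs) ≡ ∑ xs (λ x → -1ℤ ℤ.^ e x ℤ.* w (m x))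
  evaluate-monomials e m xs = trans (∑-map _ xs _) (∑-cong xs (λ _ → ℤ.*-identityˡ _))

-- Kaons

module _ {P E : A → Set} (F : Finite P) (E? : Decidable E) (f : A → ℤ) where

  -- `E` marks the elements that cancel among themselves. `ι` has to be a sign-reversing involution
  -- only there and may be arbitrary elsewhere.
  ∑-cancel : (ι : A → A) →
    (∀ {x} → P x → E x → (P (ι x) × E (ι x)) × ι (ι x) ≡ x × f (ι x) ≡ ℤ.- f x) →
    ∑ (elements F) f ≡ ∑ (List.filter (¬? ∘ E?) (elements F)) f
  ∑-cancel ι inv = trans (∑-filter E? (elements F) f) (trans
    (cong (ℤ._+ ∑ (List.filter (¬? ∘ E?) (elements F)) f)
    (∑-involution f ι (Unique.filter⁺ E? (Finite.unique F)) λ x∈ →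
      let (x∈F , Ex) = ∈ˡ.∈-filter⁻ E? {xs = elements F} x∈
          ((Pιx , Eιx) , rest) = inv (Finite.sound F x∈F) Ex
      in ∈ˡ.∈-filter⁺ E? (Finite.complete F Pιx) Eιx , rest))
    (ℤ.+-identityˡ _))

  ∑-cancel-zero : (ι : A → A) →
    (∀ {x} → P x → E x → (P (ι x) × E (ι x)) × ι (ι x) ≡ x × f (ι x) ≡ ℤ.- f x) →
    (∀ {x} → P x → ¬ E x → f x ≡ 0ℤ) →
    ∑ (elements F) f ≡ 0ℤ
  ∑-cancel-zero ι inv zeros = trans (∑-cancel ι inv)
    (∑-zero (List.filter (¬? ∘ E?) (elements F)) λ x∈ →
      let (x∈F , ¬Ex) = ∈ˡ.∈-filter⁻ (¬? ∘ E?) {xs = elements F} x∈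
      in zeros (Finite.sound F x∈F) ¬Ex)

  ∑-cancel-single : (ι : A → A) →
    (∀ {x} → P x → E x → (P (ι x) × E (ι x)) × ι (ι x) ≡ x × f (ι x) ≡ ℤ.- f x) →
    ∀ {x₀} → P x₀ → ¬ E x₀ → (∀ {x} → P x → ¬ E x → x ≢ x₀ → f x ≡ 0ℤ) →
    ∑ (elements F) f ≡ f x₀
  ∑-cancel-single ι inv Px₀ ¬Ex₀ zeros = trans (∑-cancel ι inv)
    (∑-single f (Unique.filter⁺ (¬? ∘ E?) (Finite.unique F))
      (∈ˡ.∈-filter⁺ (¬? ∘ E?) (Finite.complete F Px₀) ¬Ex₀)
      λ x∈ → let (x∈F , ¬Ex) = ∈ˡ.∈-filter⁻ (¬? ∘ E?) {xs = elements F} x∈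
             in zeros (Finite.sound F x∈F) ¬Ex)

∑-finite-single : {P : A → Set} (F : Finite P) (f : A → ℤ) → ∀ {x₀} → P x₀ →
                  (∀ {x} → P x → x ≢ x₀ → f x ≡ 0ℤ) → ∑ (elements F) f ≡ f x₀
∑-finite-single F f Px₀ zeros =
  ∑-single f (Finite.unique F) (Finite.complete F Px₀) (zeros ∘ Finite.sound F)

-- Symmetric, because a toggle may raise or lower the excess by one; either way the sign at β = -1
-- changes.
Adjacent : ℕ → ℕ → Set
Adjacent k l = l ≡ suc k ⊎ k ≡ suc l

adjacent-sign : ∀ {k l} → Adjacent k l → -1ℤ ℤ.^ l ≡ ℤ.- (-1ℤ ℤ.^ k)
adjacent-sign     (inj₁ refl) = ℤ.-1*i≡-i _
adjacent-sign {l = l} (inj₂ refl) =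
  sym (trans (cong ℤ.-_ (ℤ.-1*i≡-i (-1ℤ ℤ.^ l))) (ℤ.neg-involutive _))

-- Functionals of subsets and the supports that survive them

Within : Subset n → WeakComposition n → Set
Within S m = ∀ i → lookup m i ≢ 0 → i ∈ S

within? : (S : Subset n) → Decidable (Within S)
within? S m = Fin.all? λ i → ¬? (lookup m i ℕ.≟ 0) →-dec (i ∈? S)

evaluateOn : Subset n → Polynomial n → ℤ
evaluateOn S = evaluate (λ m → 𝟙 (within? S m))

within-tail : ∀ {x s} {m : WeakComposition n} → Within (s ∷ S) (x ∷ m) → Within S m
within-tail h i = drop-there ∘ h (suc i)

within-∷ : ∀ {x s} {m : WeakComposition n} → (x ≢ 0 → s ≡ true) → Within S m → Within (s ∷ S) (x ∷ m)
within-∷ f h zero    x≢0 rewrite f x≢0 = Vec.here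
within-∷ f h (suc i) ≢0  = Vec.there (h i ≢0)

within-head : ∀ {x s} {m : WeakComposition n} → Within (s ∷ S) (x ∷ m) → x ≢ 0 → s ≡ true
within-head h x≢0 with Vec.here ← h zero x≢0 = refl

Zero : WeakComposition n → Set
Zero = VecAll.All (_≡ 0)

-- The part of S up to the last nonzero entry of a is the support of a.
data Initial : ∀ {n} → Subset n → WeakComposition n → Set where
  []   : Initial [] []
  part : Initial S a → Initial (true ∷ S) (suc k ∷ a)
  skip : Initial S a → Initial (false ∷ S) (0 ∷ a)
  stop : Zero a → Initial (true ∷ S) (0 ∷ a)

-- Locates the toggle: the first element of `S` at which `a` is zero although a nonzero part
-- follows. Before it, `S` and the support of `a` agree.
data Gap : ∀ {n} → Subset n → WeakComposition n → Set where
  here : ¬ Zero a → Gap (true ∷ S) (0 ∷ a)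
  part : Gap S a → Gap (true ∷ S) (suc k ∷ a)
  skip : Gap S a → Gap (false ∷ S) (0 ∷ a)

zero? : Decidable (Zero {n})
zero? = VecAll.all? (ℕ._≟ 0)

initial? : (S : Subset n) → Decidable (Initial S)
initial? []          []          = yes []
initial? (true ∷ S)  (suc k ∷ a) = map′ part (λ { (part h) → h }) (initial? S a)
initial? (false ∷ S) (suc k ∷ a) = no λ ()
initial? (true ∷ S)  (0 ∷ a)     = map′ stop (λ { (stop h) → h }) (zero? a)
initial? (false ∷ S) (0 ∷ a)     = map′ skip (λ { (skip h) → h }) (initial? S a)

zero⇒within : Zero a → Within S a
zero⇒within (refl ∷ z) zero    0≢0 = contradiction refl 0≢0
zero⇒within {S = _ ∷ _} (_ ∷ z)    (suc i) ≢0  = Vec.there (zero⇒within z i ≢0)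

initial⇒within : Initial S a → Within S a
initial⇒within []       ()
initial⇒within (part h) = within-∷ (λ _ → refl) (initial⇒within h)
initial⇒within (skip h) = within-∷ (contradiction refl) (initial⇒within h)
initial⇒within (stop z) = within-∷ (contradiction refl) (zero⇒within z)

gap⇒¬initial : Gap S a → ¬ Initial S a
gap⇒¬initial (here ¬z) (stop z) = ¬z z
gap⇒¬initial (part g)  (part h) = gap⇒¬initial g h
gap⇒¬initial (skip g)  (skip h) = gap⇒¬initial g h

within⇒initial⊎gap : (S : Subset n) (a : WeakComposition n) → Within S a → Initial S a ⊎ Gap S a
within⇒initial⊎gap []          []          h = inj₁ []
within⇒initial⊎gap (true ∷ S)  (suc k ∷ a) h with within⇒initial⊎gap S a (within-tail h)
... | inj₁ i = inj₁ (part i)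
... | inj₂ g = inj₂ (part g)
within⇒initial⊎gap (false ∷ S) (suc k ∷ a) h with () ← within-head h (λ ())
within⇒initial⊎gap (true ∷ S)  (0 ∷ a)     h with zero? a
... | yes z = inj₁ (stop z)
... | no ¬z = inj₂ (here ¬z)
within⇒initial⊎gap (false ∷ S) (0 ∷ a)     h with within⇒initial⊎gap S a (within-tail h)
... | inj₁ i = inj₁ (skip i)
... | inj₂ g = inj₂ (skip g)

-- Mesonic glides read from left to right

net : Entry → ℕ
net ∅         = 0
net (black k) = suc k
net (red k)   = k

-- A reading of the definition of mesonic glides from left to right.  The state
-- is nothing as long as only ∅ has occurred in the current block, and just w
-- once the block has a nonzero entry, where w is its weight minus its excess.
data Mesonic : ∀ {n} → Maybe ℕ → WeakComposition n → WeakKomposition n → Set where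
  []    : Mesonic nothing [] []
  skip  : Mesonic nothing a b → Mesonic nothing (0 ∷ a) (∅ ∷ b)
  start : Mesonic (just (suc k)) a b → Mesonic nothing (0 ∷ a) (black k ∷ b)
  only  : Mesonic nothing a b → Mesonic nothing (suc k ∷ a) (black k ∷ b)
  more  : w + net e ≡ w′ → Mesonic (just w′) a b → Mesonic (just w) (0 ∷ a) (e ∷ b)
  close : e ≢ ∅ → w + net e ≡ suc k → Mesonic nothing a b → Mesonic (just w) (suc k ∷ a) (e ∷ b)

-- The number is the position of the last part before the one considered. It is 0 exactly for the
-- first block, the only one that begins with `B`.
earlier : ℕ → List Entry → List Entry
earlier zero    B = B
earlier (suc _) B = []

-- b is a mesonic glide of a, except that the first block begins with B.
record GlideAfter (B : List Entry) (a : WeakComposition n) (b : WeakKomposition n) : Set where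
  field
    pending  : lastNonzero (toList a) ≡ 0 → All (_≡ ∅) B
    trailing : ∀ i → lastNonzero (toList a) ≤ toℕ i → lookup b i ≡ ∅
    blocks   : ∀ p → lookup a p ≢ 0 → MesonicBlock (lookup a p)
      (earlier (lastNonzero (List.take (toℕ p) (toList a))) B ++ block a b p) (lookup b p)

open GlideAfter

-- This and the next three lemmas read one letter, splitting on `lastNonzero` of the tail. Positions
-- shift by one under a new head, except that 0, which means that there is no part, stays 0 under a
-- leading zero.
after-0∷⁻ : GlideAfter B (0 ∷ a) (e ∷ b) → GlideAfter (B ∷ʳ e) a b
after-0∷⁻ {B = B} {a = a} {e = e} {b = b} G = record
  { pending = pending′ ; trailing = trailing′ ; blocks = blocks′ }
  where
  pending′ : lastNonzero (toList a) ≡ 0 → All (_≡ ∅) (B ∷ʳ e)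
  pending′ eq with lastNonzero (toList a) | pending G | trailing G
  ... | zero | p | t = All.++⁺ (p refl) (t zero z≤n ∷ [])
  trailing′ : ∀ i → lastNonzero (toList a) ≤ toℕ i → lookup b i ≡ ∅
  trailing′ i ≤i = trailing G (suc i) (ℕ.≤-trans (lastNonzero-∷ 0 (toList a)) (s≤s ≤i))
  blocks′ : ∀ p → lookup a p ≢ 0 → MesonicBlock (lookup a p)
      (earlier (lastNonzero (List.take (toℕ p) (toList a))) (B ∷ʳ e) ++ block a b p) (lookup b p)
  blocks′ p ≢0 with lastNonzero (List.take (toℕ p) (toList a)) | blocks G (suc p) ≢0
  ... | zero  | M = subst (λ C → MesonicBlock _ C _) (sym (List.∷ʳ-++ B e _)) M
  ... | suc _ | M = M

after-0∷⁺ : GlideAfter (B ∷ʳ e) a b → GlideAfter B (0 ∷ a) (e ∷ b)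
after-0∷⁺ {B = B} {e = e} {a = a} {b = b} G = record
  { pending = pending′ ; trailing = trailing′ ; blocks = blocks′ }
  where
  pending′ : lastNonzero (0 ∷ toList a) ≡ 0 → All (_≡ ∅) B
  pending′ eq with lastNonzero (toList a) | pending G
  ... | zero | p = All.++⁻ˡ B (p refl)
  trailing′ : ∀ i → lastNonzero (0 ∷ toList a) ≤ toℕ i → lookup (e ∷ b) i ≡ ∅
  trailing′ i ≤i with lastNonzero (toList a) | pending G | trailing G
  trailing′ zero    ≤i | zero | p | t with e≡∅ ∷ [] ← All.++⁻ʳ B (p refl) = e≡∅
  trailing′ (suc i) ≤i | zero | p | t = t i z≤n
  trailing′ (suc i) ≤i | suc _ | p | t = t i (ℕ.s≤s⁻¹ ≤i)
  blocks′ : ∀ p → lookup (0 ∷ a) p ≢ 0 → MesonicBlock (lookup (0 ∷ a) p)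
      (earlier (lastNonzero (List.take (toℕ p) (0 ∷ toList a))) B ++ block (0 ∷ a) (e ∷ b) p)
      (lookup (e ∷ b) p)
  blocks′ zero    0≢0 = contradiction refl 0≢0
  blocks′ (suc p) ≢0 with lastNonzero (List.take (toℕ p) (toList a)) | blocks G p ≢0
  ... | zero  | M = subst (λ C → MesonicBlock _ C _) (List.∷ʳ-++ B e _) M
  ... | suc _ | M = M

after-suc∷⁻ : GlideAfter B (suc k ∷ a) (e ∷ b) → MesonicBlock (suc k) (B ∷ʳ e) e × GlideAfter [] a b
after-suc∷⁻ {k = k} {a = a} {e = e} {b = b} G = blocks G zero (λ ()) , record
  { pending  = λ _ → []
  ; trailing = λ i ≤i → trailing G (suc i) (ℕ.≤-trans (lastNonzero-∷ (suc k) (toList a)) (s≤s ≤i))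
  ; blocks   = blocks′ }
  where
  blocks′ : ∀ p → lookup a p ≢ 0 → MesonicBlock (lookup a p)
      (earlier (lastNonzero (List.take (toℕ p) (toList a))) [] ++ block a b p) (lookup b p)
  blocks′ p ≢0 with lastNonzero (List.take (toℕ p) (toList a)) | blocks G (suc p) ≢0
  ... | zero  | M = M
  ... | suc _ | M = M

after-suc∷⁺ : MesonicBlock (suc k) (B ∷ʳ e) e → GlideAfter [] a b → GlideAfter B (suc k ∷ a) (e ∷ b)
after-suc∷⁺ {k = k} {B = B} {e = e} {a = a} {b = b} M G = record
  { pending = pending′ ; trailing = trailing′ ; blocks = blocks′ }
  where
  pending′ : lastNonzero (suc k ∷ toList a) ≡ 0 → All (_≡ ∅) B
  pending′ eq with lastNonzero (toList a)
  pending′ () | zero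
  pending′ () | suc _
  trailing′ : ∀ i → lastNonzero (suc k ∷ toList a) ≤ toℕ i → lookup (e ∷ b) i ≡ ∅
  trailing′ i ≤i with lastNonzero (toList a) | trailing G
  trailing′ (suc i) ≤i | zero | t = t i z≤n
  trailing′ (suc i) ≤i | suc _ | t = t i (ℕ.s≤s⁻¹ ≤i)
  blocks′ : ∀ p → lookup (suc k ∷ a) p ≢ 0 → MesonicBlock (lookup (suc k ∷ a) p)
      (earlier (lastNonzero (List.take (toℕ p) (suc k ∷ toList a))) B ++ block (suc k ∷ a) (e ∷ b) p)
      (lookup (e ∷ b) p)
  blocks′ zero    _  = M
  blocks′ (suc p) ≢0 with lastNonzero (List.take (toℕ p) (toList a)) | blocks G p ≢0
  ... | zero  | N = N
  ... | suc _ | N = N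

netSum : List Entry → ℕ
netSum B = sum (List.map net B)

netSum-∷ʳ : ∀ B e → netSum (B ∷ʳ e) ≡ netSum B + net e
netSum-∷ʳ B e rewrite List.map-++ net B (e ∷ []) =
  trans (sum-++ (List.map net B) (net e ∷ [])) (cong (netSum B +_) (ℕ.+-identityʳ (net e)))

-- `net` is value minus redness, so condition (1) on a block says that its net sum is the part of
-- `a`. Unlike weight and excess separately, this is a single running total.
netSum+ex : ∀ B → netSum B + ex B ≡ sum (List.map value B)
netSum+ex []            = refl
netSum+ex (∅ ∷ B)       = netSum+ex B
netSum+ex (black k ∷ B) = cong suc (trans (ℕ.+-assoc k _ _) (cong (k +_) (netSum+ex B)))
netSum+ex (red k ∷ B)   = trans (lemma k (netSum B) (ex B)) (cong (λ s → suc (k + s)) (netSum+ex B))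
  where
  lemma : ∀ x y z → x + y + suc z ≡ suc (x + (y + z))
  lemma = ℕ-Solver.solve-∀

weight⇒netSum : k + ex B ≡ sum (List.map value B) → netSum B ≡ k
weight⇒netSum {B = B} eq = ℕ.+-cancelʳ-≡ (ex B) _ _ (trans (netSum+ex B) (sym eq))

netSum⇒weight : netSum B ≡ k → k + ex B ≡ sum (List.map value B)
netSum⇒weight {B = B} refl = netSum+ex B

-- The invariant between the state of `Mesonic` and the prefix `B` already read; `just w` records
-- that condition (2) is settled as well.
Summary : Maybe ℕ → List Entry → Set
Summary nothing  B = All (_≡ ∅) B
Summary (just w) B = LeftmostBlack B × netSum B ≡ w

leftmostBlack-++ : ∀ {C} → LeftmostBlack B → LeftmostBlack (B ++ C)
leftmostBlack-++ here      = here
leftmostBlack-++ (there h) = there (leftmostBlack-++ h)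

∅s++ : ∀ {C} → All (_≡ ∅) B → LeftmostBlack C → LeftmostBlack (B ++ C)
∅s++ []         h = h
∅s++ (refl ∷ z) h = there (∅s++ z h)

∅s++⁻ : ∀ {C} → All (_≡ ∅) B → LeftmostBlack (B ++ C) → LeftmostBlack C
∅s++⁻ []         h         = h
∅s++⁻ (refl ∷ z) (there h) = ∅s++⁻ z h

netSum-∅s++ : ∀ {C} → All (_≡ ∅) B → netSum (B ++ C) ≡ netSum C
netSum-∅s++ []         = refl
netSum-∅s++ (refl ∷ z) = netSum-∅s++ z

¬∅s : LeftmostBlack B → ¬ All (_≡ ∅) B
¬∅s (there h) (_ ∷ z) = ¬∅s h z
¬∅s here      (() ∷ _)

-- The red entry is the leftmost nonzero one. If a later part closes the block, condition (2) fails;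
-- if none does, the entry lies behind the last part, where only `∅` is allowed. `C` collects what
-- the induction reads in between.
¬after-red : ∀ {C} → All (_≡ ∅) B → ¬ GlideAfter (B ++ red k ∷ C) a b
¬after-red {B = B} {a = []}    {b = []}    z G with All.++⁻ʳ B (pending G refl)
... | () ∷ _
¬after-red {B = B} {a = zero ∷ a} {b = e ∷ b} z G =
  ¬after-red z (subst (λ D → GlideAfter D a b) (List.++-assoc B _ _) (after-0∷⁻ G))
¬after-red {B = B} {a = suc _ ∷ a} {b = e ∷ b} z G
  with () ← ∅s++⁻ z (subst LeftmostBlack (List.++-assoc B _ _)
                           (MesonicBlock.leftmost (proj₁ (after-suc∷⁻ G))))

after⇒mesonic : Summary σ B → GlideAfter B a b → Mesonic σ a b
after⇒mesonic {σ = nothing} {a = []}     {b = []}      z G = []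
after⇒mesonic {σ = just w}  {a = []}     {b = []}      (l , _) G = contradiction (pending G refl) (¬∅s l)
after⇒mesonic {σ = nothing} {a = 0 ∷ a}  {b = ∅ ∷ b}   z G =
  skip (after⇒mesonic (All.++⁺ z (refl ∷ [])) (after-0∷⁻ G))
after⇒mesonic {σ = nothing} {a = 0 ∷ a}  {b = black k ∷ b} z G =
  start (after⇒mesonic (∅s++ z here , trans (netSum-∅s++ z) (ℕ.+-identityʳ _)) (after-0∷⁻ G))
after⇒mesonic {σ = nothing} {a = 0 ∷ a}  {b = red k ∷ b} z G =
  contradiction (after-0∷⁻ G) (¬after-red z)
after⇒mesonic {σ = just w} {B} {a = 0 ∷ a}  {b = e ∷ b} (l , refl) G =
  more refl (after⇒mesonic (leftmostBlack-++ l , netSum-∷ʳ B e) (after-0∷⁻ G))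
after⇒mesonic {σ = nothing} {B} {a = suc k ∷ a} {b = e ∷ b} z G
  with M , G′ ← after-suc∷⁻ G
  -- Only `∅` precedes `e` in its block, so `e` alone must be black and carry the whole part.
  with e | ∅s++⁻ z (MesonicBlock.leftmost M)
     | trans (sym (trans (netSum-∅s++ z) (ℕ.+-identityʳ (net e))))
             (weight⇒netSum {B = B ∷ʳ e} (MesonicBlock.weight M))
... | ∅       | there () | _
... | black _ | here     | refl = only (after⇒mesonic [] G′)
after⇒mesonic {σ = just w} {B} {a = suc k ∷ a} {b = e ∷ b} (l , refl) G
  with M , G′ ← after-suc∷⁻ G =
  close (MesonicBlock.nonzero M)
        (trans (sym (netSum-∷ʳ B e)) (weight⇒netSum {B = B ∷ʳ e} (MesonicBlock.weight M)))
        (after⇒mesonic [] G′)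

mesonic⇒after : Summary σ B → Mesonic σ a b → GlideAfter B a b
mesonic⇒after z [] = record { pending = λ _ → z ; trailing = λ () ; blocks = λ () }
mesonic⇒after z (skip M) = after-0∷⁺ (mesonic⇒after (All.++⁺ z (refl ∷ [])) M)
mesonic⇒after z (start M) =
  after-0∷⁺ (mesonic⇒after (∅s++ z here , trans (netSum-∅s++ z) (ℕ.+-identityʳ _)) M)
mesonic⇒after {B = B} z (only M) = after-suc∷⁺ (record
  { weight   = netSum⇒weight {B = B ∷ʳ _} (trans (netSum-∅s++ z) (ℕ.+-identityʳ _))
  ; leftmost = ∅s++ z here
  ; nonzero  = λ () }) (mesonic⇒after [] M)
mesonic⇒after {B = B} (l , refl) (more eq M) =
  after-0∷⁺ (mesonic⇒after (leftmostBlack-++ l , trans (netSum-∷ʳ B _) eq) M)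
mesonic⇒after {B = B} (l , refl) (close e≢∅ eq M) = after-suc∷⁺ (record
  { weight   = netSum⇒weight {B = B ∷ʳ _} (trans (netSum-∷ʳ B _) eq)
  ; leftmost = leftmostBlack-++ l
  ; nonzero  = e≢∅ }) (mesonic⇒after [] M)

glide⇒mesonic : MesonicGlide a b → Mesonic nothing a b
glide⇒mesonic {a = a} {b = b} G = after⇒mesonic [] (record
  { pending = λ _ → [] ; trailing = MesonicGlide.trailing G ; blocks = blocks′ })
  where
  blocks′ : ∀ p → lookup a p ≢ 0 → MesonicBlock (lookup a p)
    (earlier (lastNonzero (List.take (toℕ p) (toList a))) [] ++ block a b p) (lookup b p)
  blocks′ p ≢0 with lastNonzero (List.take (toℕ p) (toList a)) | MesonicGlide.blocks G p ≢0
  ... | zero  | M = M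
  ... | suc _ | M = M

mesonic⇒glide : Mesonic nothing a b → MesonicGlide a b
mesonic⇒glide {a = a} {b = b} M = record { trailing = trailing G ; blocks = blocks′ }
  where
  G = mesonic⇒after [] M
  blocks′ : ∀ p → lookup a p ≢ 0 → MesonicBlock (lookup a p) (block a b p) (lookup b p)
  blocks′ p ≢0 with lastNonzero (List.take (toℕ p) (toList a)) | blocks G p ≢0
  ... | zero  | M = M
  ... | suc _ | M = M

-- The sign-reversing involution on glides.

-- e and e′ are the first nonzero entries of two otherwise equal kompositions.
data Replace (e e′ : Entry) : ∀ {n} → WeakKomposition n → WeakKomposition n → Set where
  here  : e ≢ ∅ → e′ ≢ ∅ → Replace e e′ (e ∷ b) (e′ ∷ b)
  there : Replace e e′ b b′ → Replace e e′ (∅ ∷ b) (∅ ∷ b′)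

replace-sym : Replace e e′ b b′ → Replace e′ e b′ b
replace-sym (here ≢∅ ≢∅′) = here ≢∅′ ≢∅
replace-sym (there r)     = there (replace-sym r)

first : WeakKomposition n → Entry
first []      = ∅
first (∅ ∷ b) = first b
first (e ∷ b) = e

setFirst : Entry → WeakKomposition n → WeakKomposition n
setFirst e′ []      = []
setFirst e′ (∅ ∷ b) = ∅ ∷ setFirst e′ b
setFirst e′ (e ∷ b) = e′ ∷ b

replace-first : Replace e e′ b b′ → first b ≡ e
replace-first {e = ∅}       (here ≢∅ _) = contradiction refl ≢∅
replace-first {e = black _} (here _ _)  = refl
replace-first {e = red _}   (here _ _)  = refl
replace-first (there r)                 = replace-first r

replace-setFirst : Replace e e′ b b′ → setFirst e′ b ≡ b′
replace-setFirst {e = ∅}       (here ≢∅ _) = contradiction refl ≢∅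
replace-setFirst {e = black _} (here _ _)  = refl
replace-setFirst {e = red _}   (here _ _)  = refl
replace-setFirst (there r)                 = cong (∅ ∷_) (replace-setFirst r)

-- The orbits of the toggle at the head position; the right-hand side has one more red entry, and
-- net sums agree. `split` moves the first black entry forward to the head and leaves a red 1
-- (`red 0`, of net value 0) in its place. `paint` keeps the head and exchanges `black u` with
-- `red (suc u)`, which have the same net value, at the next nonzero entry.
data Twin : ∀ {n} → WeakKomposition n → WeakKomposition n → Set where
  split : Replace (black k) (red 0) b b′ → Twin (∅ ∷ b) (black k ∷ b′)
  paint : ∀ {u} → Replace (black u) (red (suc u)) b b′ → Twin (black k ∷ b) (black k ∷ b′)

toggle∅ : Entry → WeakKomposition n → WeakKomposition (suc n)
toggle∅ (black k) b = black k ∷ setFirst (red 0) b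
-- A default: the glides to be toggled have a block after the gap, and its first nonzero entry is
-- black.
toggle∅ _         b = ∅ ∷ b

toggleBlack : ℕ → Entry → WeakKomposition n → WeakKomposition (suc n)
toggleBlack k ∅             b = black k ∷ b
toggleBlack k (black u)     b = black k ∷ setFirst (red (suc u)) b
toggleBlack k (red zero)    b = ∅ ∷ setFirst (black k) b
toggleBlack k (red (suc u)) b = black k ∷ setFirst (black u) b

toggle : WeakKomposition n → WeakKomposition n
toggle []            = []
toggle (∅ ∷ b)       = toggle∅ (first b) b
toggle (black k ∷ b) = toggleBlack k (first b) b
toggle (red k ∷ b)   = red k ∷ b

twin-toggleˡ : Twin b b′ → toggle b ≡ b′
twin-toggleˡ (split r) rewrite replace-first r = cong (black _ ∷_) (replace-setFirst r)
twin-toggleˡ (paint r) rewrite replace-first r = cong (black _ ∷_) (replace-setFirst r)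

twin-toggleʳ : Twin b b′ → toggle b′ ≡ b
twin-toggleʳ (split r) rewrite replace-first (replace-sym r) =
  cong (∅ ∷_) (replace-setFirst (replace-sym r))
twin-toggleʳ (paint r) rewrite replace-first (replace-sym r) =
  cong (black _ ∷_) (replace-setFirst (replace-sym r))

-- Moving `black k` forward only makes the state `just (suc k)` start earlier: the `∅`s in between
-- and the `red 0` left behind add nothing to it, so both readings coincide after the replaced
-- entry.
replace-split⁺ : Replace (black k) (red 0) b b′ → Mesonic nothing a b → Mesonic (just (suc k)) a b′
replace-split⁺ (here _ _) (start M) = more (ℕ.+-identityʳ _) M
replace-split⁺ (here _ _) (only M)  = close (λ ()) (ℕ.+-identityʳ _) M
replace-split⁺ (there r)  (skip M)  = more (ℕ.+-identityʳ _) (replace-split⁺ r M)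

replace-split⁻ : Replace (black k) (red 0) b b′ → Mesonic (just (suc k)) a b′ → Mesonic nothing a b
replace-split⁻ {k} (here _ _) (more refl M)    rewrite ℕ.+-identityʳ k = start M
replace-split⁻ {k} (here _ _) (close _ refl M) rewrite ℕ.+-identityʳ k = only M
replace-split⁻ {k} (there r)  (more refl M)    rewrite ℕ.+-identityʳ k = skip (replace-split⁻ r M)
replace-split⁻ (there r) (close ≢∅ _ _) = contradiction refl ≢∅

replace-paint : net e ≡ net e′ → Replace e e′ b b′ → Mesonic (just w) a b → Mesonic (just w) a b′
replace-paint {w = w} eq (here _ _) (more eq′ M) = more (trans (cong (w +_) (sym eq)) eq′) M
replace-paint {w = w} eq (here _ e′≢∅) (close _ eq′ M) =
  close e′≢∅ (trans (cong (w +_) (sym eq)) eq′) M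
replace-paint eq (there r) (more eq′ M)     = more eq′ (replace-paint eq r M)
replace-paint eq (there r) (close ≢∅ eq′ M) = contradiction refl ≢∅

twin-mesonic⁺ : Twin b b′ → Mesonic nothing (0 ∷ a) b → Mesonic nothing (0 ∷ a) b′
twin-mesonic⁺ (split r) (skip M)  = start (replace-split⁺ r M)
twin-mesonic⁺ (paint r) (start M) = start (replace-paint refl r M)

twin-mesonic⁻ : Twin b b′ → Mesonic nothing (0 ∷ a) b′ → Mesonic nothing (0 ∷ a) b
twin-mesonic⁻ (split r) (start M) = skip (replace-split⁻ r M)
twin-mesonic⁻ (paint r) (start M) = start (replace-paint refl (replace-sym r) M)

first-black : ¬ Zero a → Mesonic nothing a b → ∃₂ λ k (b′ : WeakKomposition _) → Replace (black k) (red 0) b b′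
first-black ¬z []        = contradiction [] ¬z
first-black ¬z (skip M)  =
  let (k , b′ , r) = first-black (¬z ∘ (refl ∷_)) M in k , ∅ ∷ b′ , there r
first-black ¬z (start M) = _ , _ , here (λ ()) (λ ())
first-black ¬z (only M)  = _ , _ , here (λ ()) (λ ())

-- An open block can only end through `close`, at a nonzero entry; this is condition (3).
first-nonzero : Mesonic (just w) a b → ∃ λ e → e ≢ ∅ × ∀ e′ → e′ ≢ ∅ → ∃ λ (b′ : WeakKomposition _) → Replace e e′ b b′
first-nonzero (close ≢∅ _ M) = _ , ≢∅ , λ e′ ≢∅′ → _ , here ≢∅ ≢∅′
first-nonzero (more {e = ∅} _ M) =
  let (e , ≢∅ , r) = first-nonzero M
  in e , ≢∅ , λ e′ ≢∅′ → _ , there (proj₂ (r e′ ≢∅′))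
first-nonzero (more {e = black _} _ M) = _ , (λ ()) , λ e′ ≢∅′ → _ , here (λ ()) ≢∅′
first-nonzero (more {e = red _}   _ M) = _ , (λ ()) , λ e′ ≢∅′ → _ , here (λ ()) ≢∅′

-- If the head is empty, the first block after it supplies the black entry to move. If the head is
-- black, its block must still close, and the next nonzero entry decides: `red 0` undoes a split,
-- anything else is repainted.
hasTwin : ¬ Zero a → Mesonic nothing (0 ∷ a) b → ∃ λ b′ → Twin b b′ ⊎ Twin b′ b
hasTwin ¬z (skip M) = let (k , b′ , r) = first-black ¬z M in _ , inj₁ (split r)
hasTwin ¬z (start M) with first-nonzero M
... | ∅           , ≢∅ , _ = contradiction refl ≢∅
... | black u     , _  , r = _ , inj₁ (paint (proj₂ (r (red (suc u)) (λ ()))))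
... | red zero    , _  , r = _ , inj₂ (split (replace-sym (proj₂ (r (black _) (λ ())))))
... | red (suc u) , _  , r = _ , inj₂ (paint (replace-sym (proj₂ (r (black u) (λ ())))))

values : WeakKomposition n → WeakComposition n
values = Vec.map value

value≢0 : e ≢ ∅ → value e ≢ 0
value≢0 {∅}       ≢∅ = contradiction refl ≢∅
value≢0 {black _} _  = λ ()
value≢0 {red _}   _  = λ ()

replace-within : Replace e e′ b b′ → Within S (values b) → Within S (values b′)
replace-within {S = _ ∷ _} (here ≢∅ _) h = within-∷ (λ _ → within-head h (value≢0 ≢∅)) (within-tail h)
replace-within {S = _ ∷ _} (there r)   h = within-∷ (contradiction refl) (replace-within r (within-tail h))

twin-within⁺ : Twin b b′ → Within (true ∷ S) (values b) → Within (true ∷ S) (values b′)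
twin-within⁺ (split r) h = within-∷ (λ _ → refl) (replace-within r (within-tail h))
twin-within⁺ (paint r) h = within-∷ (λ _ → refl) (replace-within r (within-tail h))

twin-within⁻ : Twin b b′ → Within (true ∷ S) (values b′) → Within (true ∷ S) (values b)
twin-within⁻ (split r) h = within-∷ (λ _ → refl) (replace-within (replace-sym r) (within-tail h))
twin-within⁻ (paint r) h = within-∷ (λ _ → refl) (replace-within (replace-sym r) (within-tail h))

replace-ex : ∀ {u} → Replace (black k) (red u) b b′ → ex (toList b′) ≡ suc (ex (toList b))
replace-ex (here _ _) = refl
replace-ex (there r)  = replace-ex r

twin-ex : Twin b b′ → ex (toList b′) ≡ suc (ex (toList b))
twin-ex (split r) = replace-ex r
twin-ex (paint r) = replace-ex r

toggleAt : Gap S a → WeakKomposition n → WeakKomposition n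
toggleAt (here _) b       = toggle b
toggleAt (part g) []      = []
toggleAt (part g) (e ∷ b) = e ∷ toggleAt g b
toggleAt (skip g) []      = []
toggleAt (skip g) (e ∷ b) = e ∷ toggleAt g b

adjacent-+ : ∀ r {k l} → Adjacent k l → Adjacent (r + k) (r + l)
adjacent-+ r (inj₁ refl) = inj₁ (ℕ.+-suc r _)
adjacent-+ r (inj₂ refl) = inj₂ (ℕ.+-suc r _)

-- Up to the gap, a glide supported in `S` is forced: nothing may stand outside `S`, and every part
-- of `a` is a block with a single black entry. So the gap is always reached in the state `nothing`.
toggleAt-involution : {S : Subset n} {a : WeakComposition n} (g : Gap S a) {b : WeakKomposition n} →
  Mesonic nothing a b → Within S (values b) →
  (Mesonic nothing a (toggleAt g b) × Within S (values (toggleAt g b))) ×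
  toggleAt g (toggleAt g b) ≡ b × Adjacent (ex (toList b)) (ex (toList (toggleAt g b)))
toggleAt-involution (here ¬z) M h with hasTwin ¬z M
... | b′ , inj₁ t rewrite twin-toggleˡ t =
  (twin-mesonic⁺ t M , twin-within⁺ t h) , twin-toggleʳ t , inj₁ (twin-ex t)
... | b′ , inj₂ t rewrite twin-toggleʳ t =
  (twin-mesonic⁻ t M , twin-within⁻ t h) , twin-toggleˡ t , inj₂ (twin-ex t)
toggleAt-involution (part g) (only M) h =
  let ((M′ , h′) , eq , adj) = toggleAt-involution g M (within-tail h)
  in (only M′ , within-∷ (λ _ → refl) h′) , cong (_ ∷_) eq , adj
toggleAt-involution (skip g) (skip M) h =
  let ((M′ , h′) , eq , adj) = toggleAt-involution g M (within-tail h)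
  in (skip M′ , within-∷ (contradiction refl) h′) , cong (_ ∷_) eq , adj
toggleAt-involution (skip g) (start M) h with () ← within-head h (λ ())

-- The value of a functional on a kaon

blacken : ℕ → Entry
blacken zero    = ∅
blacken (suc k) = black k

mesonic-blacken : (a : WeakComposition n) → Mesonic nothing a (Vec.map blacken a)
mesonic-blacken []          = []
mesonic-blacken (zero ∷ a)  = skip (mesonic-blacken a)
mesonic-blacken (suc k ∷ a) = only (mesonic-blacken a)

values-blacken : (a : WeakComposition n) → values (Vec.map blacken a) ≡ a
values-blacken []          = refl
values-blacken (zero ∷ a)  = cong (0 ∷_) (values-blacken a)
values-blacken (suc k ∷ a) = cong (suc k ∷_) (values-blacken a)

ex-blacken : (a : WeakComposition n) → ex (toList (Vec.map blacken a)) ≡ 0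
ex-blacken []          = refl
ex-blacken (zero ∷ a)  = ex-blacken a
ex-blacken (suc k ∷ a) = ex-blacken a

zero-¬mesonic : Zero a → ¬ Mesonic (just w) a b
zero-¬mesonic (refl ∷ z) (more _ M) = zero-¬mesonic z M

zero-mesonic : Zero a → Mesonic nothing a b → b ≡ Vec.map blacken a
zero-mesonic []         []        = refl
zero-mesonic (refl ∷ z) (skip M)  = cong (∅ ∷_) (zero-mesonic z M)
zero-mesonic (refl ∷ z) (start M) = contradiction M (zero-¬mesonic z)

-- Every earlier start of a block would use a position outside `S`, and behind the last part no
-- block can start at all.
initial-mesonic : Initial S a → Mesonic nothing a b → Within S (values b) → b ≡ Vec.map blacken a
initial-mesonic []       []        h = refl
initial-mesonic (part i) (only M)  h = cong (_ ∷_) (initial-mesonic i M (within-tail h))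
initial-mesonic (skip i) (skip M)  h = cong (_ ∷_) (initial-mesonic i M (within-tail h))
initial-mesonic (skip i) (start M) h with () ← within-head h (λ ())
initial-mesonic (stop z) M         h = zero-mesonic (refl ∷ z) M

-- By condition (3), `b` is nonzero wherever `a` is.
mesonic-within : Mesonic σ a b → Within S (values b) → Within S a
mesonic-within {S = []} [] h = h
mesonic-within {S = _ ∷ _} (skip M)  h = within-∷ (contradiction refl) (mesonic-within M (within-tail h))
mesonic-within {S = _ ∷ _} (start M) h = within-∷ (contradiction refl) (mesonic-within M (within-tail h))
mesonic-within {S = _ ∷ _} (only M)  h = within-∷ (λ _ → within-head h (λ ())) (mesonic-within M (within-tail h))
mesonic-within {S = _ ∷ _} (more _ M) h = within-∷ (contradiction refl) (mesonic-within M (within-tail h))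
mesonic-within {S = _ ∷ _} (close ≢∅ _ M) h =
  within-∷ (λ _ → within-head h (value≢0 ≢∅)) (mesonic-within M (within-tail h))

signed : Subset n → ℕ → WeakComposition n → ℤ
signed S k m = -1ℤ ℤ.^ k ℤ.* 𝟙 (within? S m)

module _ {S : Subset n} where

  signed-¬within : ∀ k m → ¬ Within S m → signed S k m ≡ 0ℤ
  signed-¬within k m ¬h =
    trans (cong (-1ℤ ℤ.^ k ℤ.*_) (𝟙-no (within? S m) ¬h)) (ℤ.*-zeroʳ (-1ℤ ℤ.^ k))

  signed-adjacent : ∀ {k l} m m′ → Within S m → Within S m′ → Adjacent k l →
                    signed S l m′ ≡ ℤ.- signed S k m
  signed-adjacent {k} m m′ h h′ adj
    rewrite 𝟙-yes (within? S m) h | 𝟙-yes (within? S m′) h′ =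
    trans (cong (ℤ._* 1ℤ) (adjacent-sign adj)) (sym (ℤ.neg-distribˡ-* (-1ℤ ℤ.^ k) 1ℤ))

  signed-0 : ∀ {k} m → k ≡ 0 → Within S m → signed S k m ≡ 1ℤ
  signed-0 m refl h rewrite 𝟙-yes (within? S m) h = refl

evaluateOn-kaon : (S : Subset n) (a : WeakComposition n) → evaluateOn S (kaon a) ≡ 𝟙 (initial? S a)
evaluateOn-kaon S a = trans (evaluate-monomials _ (ex ∘ toList) values (elements (mesonicGlides a))) sum≡
  where
  f : WeakKomposition _ → ℤ
  f b = signed S (ex (toList b)) (values b)
  f-¬within : ∀ b → ¬ Within S (values b) → f b ≡ 0ℤ
  f-¬within b = signed-¬within (ex (toList b)) (values b)
  sum≡ : ∑ (elements (mesonicGlides a)) f ≡ 𝟙 (initial? S a)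
  sum≡ with within? S a
  ... | no ¬h = trans
    (∑-zero (elements (mesonicGlides a)) λ {b} b∈ → f-¬within b
      (¬h ∘ mesonic-within (glide⇒mesonic (Finite.sound (mesonicGlides a) b∈))))
    (sym (𝟙-no (initial? S a) (¬h ∘ initial⇒within)))
  ... | yes h with within⇒initial⊎gap S a h
  ...   | inj₂ g = trans
    (∑-cancel-zero (mesonicGlides a) (within? S ∘ values) f (toggleAt g)
      (λ {b} G h → let ((M , h′) , eq , adj) = toggleAt-involution g (glide⇒mesonic G) h
        in (mesonic⇒glide M , h′) , eq ,
           signed-adjacent (values b) (values (toggleAt g b)) h h′ adj)
      (λ {b} _ → f-¬within b))
    (sym (𝟙-no (initial? S a) (gap⇒¬initial g)))
  ...   | inj₁ i = trans
    (∑-finite-single (mesonicGlides a) f (mesonic⇒glide (mesonic-blacken a))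
      (λ {b} G b≢ → f-¬within b (b≢ ∘ initial-mesonic i (glide⇒mesonic G))))
    (trans (signed-0 (values (Vec.map blacken a)) (ex-blacken a)
                     (subst (Within S) (sym (values-blacken a)) h))
           (sym (𝟙-yes (initial? S a) i)))

-- Lascoux atoms

anchor-unique : {R : Subset n} {x y : Fin n} → Anchor R x → Anchor R y → x ≡ y
anchor-unique (x∈ , max) (y∈ , max′) = Fin.≤-antisym (max′ _ x∈) (max _ y∈)

nonempty⇒anchor : {R : Subset n} → Nonempty R → ∃ (Anchor R)
nonempty⇒anchor {R = s ∷ R} ne with nonempty? R | ne
... | yes ne′ | _ = let (x , x∈ , max) = nonempty⇒anchor ne′ in
  suc x , Vec.there x∈ , λ { zero _ → z≤n ; (suc y) (Vec.there y∈) → s≤s (max y y∈) }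
... | no ¬ne  | suc x , Vec.there x∈ = contradiction (x , x∈) ¬ne
... | no ¬ne  | zero  , 0∈ =
  zero , 0∈ , λ { zero _ → z≤n ; (suc y) (Vec.there y∈) → contradiction (y , y∈) ¬ne }

-- The default `d` is returned only for an empty box, which semistandard fillings do not have.
anchorOr : Fin n → Subset n → Fin n
anchorOr d R with Fin.any? (anchor? R)
... | yes (x , _) = x
... | no _        = d

anchorOr-anchor : ∀ d {R : Subset n} {x} → Anchor R x → anchorOr d R ≡ x
anchorOr-anchor d {R} anc with Fin.any? (anchor? R)
... | yes (_ , anc′) = anchor-unique anc′ anc
... | no ¬anc        = contradiction (_ , anc) ¬anc

-- Changing one entry of one box

flip : Fin n → Subset n → Subset n
flip i R = Vec.updateAt R i not

flip-∈⁻ : ∀ i (R : Subset n) {x} → x ∈ flip i R → x ∈ R ⊎ x ≡ i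
flip-∈⁻ zero    (s ∷ R) {zero}  _              = inj₂ refl
flip-∈⁻ zero    (s ∷ R) {suc x} (Vec.there x∈) = inj₁ (Vec.there x∈)
flip-∈⁻ (suc i) (s ∷ R) {zero}  Vec.here       = inj₁ Vec.here
flip-∈⁻ (suc i) (s ∷ R) {suc x} (Vec.there x∈) with flip-∈⁻ i R x∈
... | inj₁ x∈R = inj₁ (Vec.there x∈R)
... | inj₂ x≡i = inj₂ (cong suc x≡i)

flip-∈⁺ : ∀ i (R : Subset n) {x} → x ∈ R → x ≢ i → x ∈ flip i R
flip-∈⁺ i R x∈ x≢i = Vec.updateAt-minimal _ i R x≢i x∈

flip-flip : ∀ i (R : Subset n) → flip i (flip i R) ≡ R
flip-flip i R = trans (Vec.updateAt-updateAt i R)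
  (Vec.updateAt-id-local i R (Bool.not-involutive (lookup R i)))

flip-∣∣ : ∀ i (R : Subset n) → Adjacent ∣ R ∣ ∣ flip i R ∣
flip-∣∣ zero    (true ∷ R)  = inj₂ refl
flip-∣∣ zero    (false ∷ R) = inj₁ refl
flip-∣∣ (suc i) (true ∷ R)  = adjacent-+ 1 (flip-∣∣ i R)
flip-∣∣ (suc i) (false ∷ R) = flip-∣∣ i R

at : {a : Vec ℕ m} → VecAll.All (Vec A) a → Box a → A
at T (box i c) = lookup (VecAll.lookup⁺ T i) c

adjust : {a : Vec ℕ m} → (A → A) → VecAll.All (Vec A) a → Box a → VecAll.All (Vec A) a
adjust g (R ∷ T) (box zero c)    = Vec.updateAt R c g ∷ T
adjust g (R ∷ T) (box (suc i) c) = R ∷ adjust g T (box i c)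

box-ext : {a : Vec ℕ m} {p q : Box a} → row p ≡ row q → column p ≡ column q → p ≡ q
box-ext {p = box i c} {box .i d} refl eq = cong (box i) (Fin.toℕ-injective eq)

next : ∀ {k} {a : Vec ℕ m} → Box a → Box (k ∷ a)
next (box i c) = box (suc i) c

at-adjust : {a : Vec ℕ m} (g : A → A) (T : VecAll.All (Vec A) a) (p : Box a) →
            at (adjust g T p) p ≡ g (at T p)
at-adjust g (R ∷ T) (box zero c)    = Vec.lookup∘updateAt c R
at-adjust g (R ∷ T) (box (suc i) c) = at-adjust g T (box i c)

at-adjust-≢ : {a : Vec ℕ m} (g : A → A) (T : VecAll.All (Vec A) a) {p q : Box a} → q ≢ p →
              at (adjust g T p) q ≡ at T q
at-adjust-≢ g (R ∷ T) {box zero c}    {box zero d}    q≢p =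
  Vec.lookup∘updateAt′ d c (λ { refl → q≢p refl }) R
at-adjust-≢ g (R ∷ T) {box zero c}    {box (suc j) d} q≢p = refl
at-adjust-≢ g (R ∷ T) {box (suc i) c} {box zero d}    q≢p = refl
at-adjust-≢ g (R ∷ T) {box (suc i) c} {box (suc j) d} q≢p =
  at-adjust-≢ g T {box i c} {box j d} (q≢p ∘ cong next)

adjust-adjust : {a : Vec ℕ m} (g : A → A) → (∀ x → g (g x) ≡ x) →
                (T : VecAll.All (Vec A) a) (p : Box a) → adjust g (adjust g T p) p ≡ T
adjust-adjust g inv (R ∷ T) (box zero c)    = cong (_∷ T)
  (trans (Vec.updateAt-updateAt c R) (Vec.updateAt-id-local c R (inv (lookup R c))))
adjust-adjust g inv (R ∷ T) (box (suc i) c) = cong (R ∷_) (adjust-adjust g inv T (box i c))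

at-injective : {a : Vec ℕ m} {T U : VecAll.All (Vec A) a} → (∀ p → at T p ≡ at U p) → T ≡ U
at-injective {T = []}    {[]}    eq = refl
at-injective {T = R ∷ T} {Q ∷ U} eq = cong₂ _∷_
  (trans (sym (Vec.tabulate∘lookup R))
    (trans (Vec.tabulate-cong (λ c → eq (box zero c))) (Vec.tabulate∘lookup Q)))
  (at-injective (eq ∘ next))

at-∈-contents : {a : Vec ℕ m} (T : VecAll.All (Vec A) a) (p : Box a) → at T p ∈ˡ contents T
at-∈-contents (R ∷ T) (box zero c)    = ∈ˡ.∈-++⁺ˡ (lookup-∈-toList R c)
at-∈-contents (R ∷ T) (box (suc i) c) = ∈ˡ.∈-++⁺ʳ (toList R) (at-∈-contents T (box i c))

∈-toList⇒lookup : ∀ {x} (v : Vec A n) → x ∈ˡ toList v → ∃ λ i → lookup v i ≡ x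
∈-toList⇒lookup (y ∷ v) (here refl) = zero , refl
∈-toList⇒lookup (y ∷ v) (there x∈)  = let (i , eq) = ∈-toList⇒lookup v x∈ in suc i , eq

∈-contents⇒at : ∀ {x} {a : Vec ℕ m} (T : VecAll.All (Vec A) a) → x ∈ˡ contents T →
                ∃ λ p → at T p ≡ x
∈-contents⇒at (R ∷ T) x∈ with ∈ˡ.∈-++⁻ (toList R) x∈
... | inj₁ x∈R = let (c , eq) = ∈-toList⇒lookup R x∈R in box zero c , eq
... | inj₂ x∈T = let (p , eq) = ∈-contents⇒at T x∈T in next p , eq

module _ (h : A → ℕ) where

  total : List A → ℕ
  total xs = sum (List.map h xs)

  total-++ : ∀ xs ys → total (xs ++ ys) ≡ total xs + total ys
  total-++ xs ys = trans (cong sum (List.map-++ h xs ys)) (sum-++ (List.map h xs) (List.map h ys))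

  total-updateAt : ∀ g (v : Vec A n) c → Adjacent (h (lookup v c)) (h (g (lookup v c))) →
    Adjacent (total (toList v)) (total (toList (Vec.updateAt v c g)))
  total-updateAt g (x ∷ v) zero adj =
    subst₂ Adjacent (ℕ.+-comm _ (h x)) (ℕ.+-comm _ (h (g x))) (adjacent-+ (total (toList v)) adj)
  total-updateAt g (x ∷ v) (suc c) adj = adjacent-+ (h x) (total-updateAt g v c adj)

  total-adjust : ∀ g {a : Vec ℕ m} (T : VecAll.All (Vec A) a) p →
    Adjacent (h (at T p)) (h (g (at T p))) →
    Adjacent (total (contents T)) (total (contents (adjust g T p)))
  total-adjust g (R ∷ T) (box zero c) adj
    rewrite total-++ (toList R) (contents T)
          | total-++ (toList (Vec.updateAt R c g)) (contents T) =
    subst₂ Adjacent (ℕ.+-comm (total (contents T)) _) (ℕ.+-comm (total (contents T)) _)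
      (adjacent-+ (total (contents T)) (total-updateAt g R c adj))
  total-adjust g (R ∷ T) (box (suc i) c) adj
    rewrite total-++ (toList R) (contents T)
          | total-++ (toList R) (contents (adjust g T (box i c))) =
    adjacent-+ (total (toList R)) (total-adjust g T (box i c) adj)

  length≤total : (v : Vec A n) → (∀ c → 1 ≤ h (lookup v c)) → n ≤ total (toList v)
  length≤total []      h≥1 = z≤n
  length≤total (x ∷ v) h≥1 = ℕ.+-mono-≤ (h≥1 zero) (length≤total v (h≥1 ∘ suc))

  size≤total : {a : Vec ℕ m} (T : VecAll.All (Vec A) a) → (∀ p → 1 ≤ h (at T p)) →
               size a ≤ total (contents T)
  size≤total []      h≥1 = z≤n
  size≤total (R ∷ T) h≥1 rewrite total-++ (toList R) (contents T) =
    ℕ.+-mono-≤ (length≤total R (h≥1 ∘ box zero)) (size≤total T (h≥1 ∘ next))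

  total≤length : (v : Vec A n) → (∀ c → h (lookup v c) ≤ 1) → total (toList v) ≤ n
  total≤length []      h≤1 = z≤n
  total≤length (x ∷ v) h≤1 = ℕ.+-mono-≤ (h≤1 zero) (total≤length v (h≤1 ∘ suc))

  total≤size : {a : Vec ℕ m} (T : VecAll.All (Vec A) a) → (∀ p → h (at T p) ≤ 1) →
               total (contents T) ≤ size a
  total≤size []      h≤1 = z≤n
  total≤size (R ∷ T) h≤1 rewrite total-++ (toList R) (contents T) =
    ℕ.+-mono-≤ (total≤length R (h≤1 ∘ box zero)) (total≤size T (h≤1 ∘ next))

-- The bounds keep the truncated subtraction in `excess` from merging the two values. They will come
-- from the fact that every box holds at least one entry.
adjacent-∸ : ∀ {k l s} → s ≤ k → s ≤ l → Adjacent k l → Adjacent (k ∸ s) (l ∸ s)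
adjacent-∸ s≤k s≤l (inj₁ refl) = inj₁ (ℕ.+-∸-assoc 1 s≤k)
adjacent-∸ s≤k s≤l (inj₂ refl) = inj₂ (ℕ.+-∸-assoc 1 s≤l)

nonempty⇒1≤∣∣ : {R : Subset n} → Nonempty R → 1 ≤ ∣ R ∣
nonempty⇒1≤∣∣ {R = true ∷ R}  _                  = s≤s z≤n
nonempty⇒1≤∣∣ {R = false ∷ R} (suc x , Vec.there x∈) = nonempty⇒1≤∣∣ (x , x∈)

Entries : Subset n → {a : WeakComposition n} → Filling a → Set
Entries S T = ∀ p x → x ∈ T ⟦ p ⟧ → x ∈ S

filter≢[] : {P : A → Set} (P? : Decidable P) (xs : List A) →
            List.length (List.filter P? xs) ≢ 0 → ∃ λ x → x ∈ˡ xs × P x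
filter≢[] P? xs ≢0 with List.filter P? xs in eq
... | []     = contradiction refl ≢0
... | x ∷ ys = x , ∈ˡ.∈-filter⁻ P? {xs = xs} (subst (x ∈ˡ_) (sym eq) (here refl))

∈⇒length≢0 : ∀ {x} {xs : List A} → x ∈ˡ xs → List.length xs ≢ 0
∈⇒length≢0 (here _)  = λ ()
∈⇒length≢0 (there _) = λ ()

module _ {S : Subset n} {a : WeakComposition n} {T : Filling a} where

  entries⇒within : Entries S T → Within S (weight T)
  entries⇒within h i ≢0 =
    let (R , R∈ , i∈R) = filter≢[] (i ∈?_) (contents T)
                           (subst (_≢ 0) (Vec.lookup∘tabulate _ i) ≢0)
        (p , eq) = ∈-contents⇒at T R∈
    in h p i (subst (i ∈_) (sym eq) i∈R)

  within⇒entries : Within S (weight T) → Entries S T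
  within⇒entries h p x x∈ = h x (subst (_≢ 0) (sym (Vec.lookup∘tabulate _ x))
    (∈⇒length≢0 (∈ˡ.∈-filter⁺ (x ∈?_) (at-∈-contents T p) x∈)))

-- Semistandardness in terms of anchors

module _ {n : ℕ} {a : WeakComposition n} where

  -- Only the neighbour on the right is asked about: an entry below the anchor of `p` does not
  -- change the maximum of `p`, hence not the comparison with the box on the left.
  Fits : (Box a → Fin n) → Box a → Fin n → Set
  Fits α p x = ∀ q → ImmediatelyRightOf q p → α q Fin.≤ x

  -- Semistandardness of F in terms of the map α from boxes to their anchors.
  record Anchored (F : Box a → Subset n) (α : Box a → Fin n) : Set where
    field
      anchors  : ∀ p → Anchor (F p) (α p)
      distinct : ∀ p q → SameColumn p q → ∀ x → x ∈ F p → x ∈ F q → p ≡ q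
      rows     : ∀ p x → x ∈ F p → Fits α p x
      triple   : ∀ p q r → ImmediatelyRightOf p q → RowAtLeast {a = a} (row p) (row r) →
                 (row p Fin.< row r × SameColumn r p) ⊎ (row r Fin.< row q × SameColumn r q) →
                 α r Fin.< α p ⊎ α q Fin.< α r
      low      : ∀ p q → SameColumn p q → ∀ x → x ∈ F p → x Fin.< α q → α q Fin.< α p → ¬ Fits α q x
      left     : ∀ p → column p ≡ 0 → α p ≡ row p

    anchor∈ : ∀ p → α p ∈ F p
    anchor∈ p = proj₁ (anchors p)

    ≤anchor : ∀ p {x} → x ∈ F p → x Fin.≤ α p
    ≤anchor p x∈ = proj₂ (anchors p) _ x∈

  open Anchored

  rightOf-≢ : ∀ {p q r : Box a} → SameColumn p q → ImmediatelyRightOf r q → r ≢ p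
  rightOf-≢ same (_ , eq) refl = ℕ.1+n≢n (trans (sym eq) same)

  module _ (x : Fin n) (p q : Box a) (F : Box a → Subset n) where

    move-∈⁻ : ∀ r {y} → y ∈ move x p q F r → y ∈ F r ⊎ (r ≡ q × y ≡ x)
    move-∈⁻ r y∈ with r ≟ᵇ q | r ≟ᵇ p
    ... | no _  | yes _ = inj₁ (p─q⊆p (F r) ⁅ x ⁆ y∈)
    ... | no _  | no _  = inj₁ y∈
    ... | yes r≡q | _   with x∈p∪q⁻ (F r) ⁅ x ⁆ y∈
    ...   | inj₁ y∈F = inj₁ y∈F
    ...   | inj₂ y∈x = inj₂ (r≡q , x∈⁅y⁆⇒x≡y x y∈x)

    move-target : x ∈ move x p q F q
    move-target with q ≟ᵇ q
    ... | yes _ = x∈p∪q⁺ (inj₂ (x∈⁅x⁆ x))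
    ... | no ≢q = contradiction refl ≢q

    move-other : ∀ r → r ≢ q → r ≢ p → move x p q F r ≡ F r
    move-other r r≢q r≢p with r ≟ᵇ q | r ≟ᵇ p
    ... | yes r≡q | _       = contradiction r≡q r≢q
    ... | no _    | yes r≡p = contradiction r≡p r≢p
    ... | no _    | no _    = refl

  anchorsOf : (Box a → Subset n) → Box a → Fin n
  anchorsOf F p = anchorOr (row p) (F p)

  anchored⇒anchorsOf : ∀ {F α} → Anchored F α → ∀ p → anchorsOf F p ≡ α p
  anchored⇒anchorsOf A p = anchorOr-anchor (row p) (anchors A p)

  semistandard⇒anchored : ∀ {F} → Semistandard F → Anchored F (anchorsOf F)
  semistandard⇒anchored {F} ss = record
    { anchors  = ancs
    ; distinct = dist
    ; rows     = λ p x x∈ q right → rowsDecrease p q right x (α q) x∈ (proj₁ (ancs q))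
    ; triple   = λ p q r right atLeast pos →
        tripleCondition p q r right atLeast pos _ _ _ (ancs p) (ancs q) (ancs r)
    ; low      = λ p q same x x∈ x<q q<p fits →
        freeEntriesLow p q same x (α p) (α q)
          (x∈ , λ anc → Fin.<-irrefl (anchor-unique anc (ancs p)) (Fin.<-trans x<q q<p))
          (ancs p) (ancs q) x<q q<p (moved p q same x x<q fits)
    ; left     = λ p eq → anchor-unique (ancs p) (leftmostAnchors p eq)
    }
    where
    open Semistandard ss
    α = anchorsOf F
    ancs : ∀ p → Anchor (F p) (α p)
    ancs p with (x , anc) ← nonempty⇒anchor (nonempty p) =
      subst (Anchor (F p)) (sym (anchorOr-anchor (row p) anc)) anc
    dist : ∀ p q → SameColumn p q → ∀ x → x ∈ F p → x ∈ F q → p ≡ q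
    dist p q same x x∈p x∈q with p ≟ᵇ q
    ... | yes p≡q = p≡q
    ... | no  p≢q = contradiction x∈q (columnsDistinct p q same p≢q x x∈p)
    moved : ∀ p q → SameColumn p q → ∀ x → x Fin.< α q → Fits α q x → RowsDecrease (move x p q F)
    moved p q same x x<q fits u v right y z y∈ z∈ with move-∈⁻ x p q F u y∈ | move-∈⁻ x p q F v z∈
    ... | inj₁ y∈F | inj₁ z∈F = rowsDecrease u v right y z y∈F z∈F
    -- The moved entry has arrived in `v`. It lies below the anchor of `v`, which already respects
    -- the box on the left.
    ... | inj₁ y∈F | inj₂ (refl , refl) =
      ℕ.≤-trans (ℕ.<⇒≤ x<q) (rowsDecrease u v right y (α v) y∈F (proj₁ (ancs v)))
    ... | inj₂ (refl , refl) | inj₁ z∈F = ℕ.≤-trans (proj₂ (ancs v) z z∈F) (fits v right)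
    ... | inj₂ (refl , refl) | inj₂ (refl , refl) = Fin.≤-refl

  anchored⇒semistandard : ∀ {F α} → Anchored F α → Semistandard F
  anchored⇒semistandard {F} {α} A = record
    { nonempty        = λ p → α p , anchor∈ A p
    ; columnsDistinct = λ p q same p≢q x x∈p x∈q → p≢q (distinct A p q same x x∈p x∈q)
    ; rowsDecrease    = λ p q right x y x∈ y∈ → ℕ.≤-trans (≤anchor A q y∈) (rows A p x x∈ q right)
    ; tripleCondition = λ p q r right atLeast pos α′ β γ ancp ancq ancr →
        subst₂ _⊎_ (cong₂ Fin._<_ (α≡ ancr) (α≡ ancp)) (cong₂ Fin._<_ (α≡ ancq) (α≡ ancr))
          (triple A p q r right atLeast pos)
    ; freeEntriesLow  = λ p q same x _ _ (x∈ , _) ancp ancq x<q q<p decrease →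
        low A p q same x x∈ (subst (x Fin.<_) (sym (α≡ ancq)) x<q)
          (subst₂ Fin._<_ (sym (α≡ ancq)) (sym (α≡ ancp)) q<p)
          -- The box `r` is one column to the right of both `p` and `q`, so the move leaves it alone
          -- and `α r` still stands in it.
          (λ r right → decrease q r right x (α r) (move-target x p q F)
            (subst (α r ∈_) (sym (move-other x p q F r (rightOf-≢ refl right) (rightOf-≢ same right)))
                   (anchor∈ A r)))
    ; leftmostAnchors = λ p eq → subst (Anchor (F p)) (left A p eq) (anchors A p)
    }
    where
    α≡ : ∀ {p x} → Anchor (F p) x → α p ≡ x
    α≡ {p} anc = anchor-unique (anchors A p) anc

  -- The entry i of S can be removed from, or added to, the box p as a free entry.
  record Slot (S : Subset n) (α : Box a → Fin n) (p : Box a) (i : Fin n) : Set where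
    constructor slot
    field
      allowed : i ∈ S
      below   : i Fin.< α p
      fits    : Fits α p i
      fresh   : ∀ q → SameColumn p q → α q ≢ i
      lowest  : ∀ q → SameColumn p q → i Fin.< α q → Fits α q i → α p Fin.≤ α q

  open Slot

  fits? : ∀ α p i → Dec (Fits α p i)
  fits? α p i = allBoxes? λ q → rightOf? q p →-dec (α q Fin.≤? i)

  slot? : ∀ S α → Decidable (uncurry (Slot S α))
  slot? S α (p , i) = map′
    (λ (s , b , f , u , l) → slot s b f u l)
    (λ s → allowed s , below s , fits s , fresh s , lowest s)
    ((i ∈? S) ×-dec (i Fin.<? α p) ×-dec fits? α p i
      ×-dec (allBoxes? λ q → sameColumn? p q →-dec ¬? (α q Fin.≟ i))
      ×-dec (allBoxes? λ q → sameColumn? p q →-dec (i Fin.<? α q) →-dec fits? α q i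
                             →-dec (α p Fin.≤? α q)))

  slot-resp : ∀ {S α α′ p i} → (∀ q → α q ≡ α′ q) → Slot S α p i → Slot S α′ p i
  slot-resp {i = i} eq (slot s b f u l) = slot s
    (subst (i Fin.<_) (eq _) b)
    (λ q right → subst (Fin._≤ i) (eq q) (f q right))
    (λ q same → subst (_≢ i) (eq q) (u q same))
    (λ q same i<q fit → subst₂ Fin._≤_ (eq _) (eq q)
      (l q same (subst (i Fin.<_) (sym (eq q)) i<q)
        (λ r right → subst (Fin._≤ i) (sym (eq r)) (fit r right))))

  boxes : List (Box a)
  boxes = List.concatMap (λ i → List.map (box i) (List.allFin (lookup a i))) (List.allFin n)

  ∈-boxes : ∀ p → p ∈ˡ boxes
  ∈-boxes (box i c) =
    ∈ˡ.∈-concat⁺′ (∈ˡ.∈-map⁺ (box i) (∈ˡ.∈-allFin c)) (∈ˡ.∈-map⁺ _ (∈ˡ.∈-allFin i))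

  abstract
    slots : Subset n → (Box a → Fin n) → List (Box a × Fin n)
    slots S α = List.filter (slot? S α) (List.cartesianProduct boxes (List.allFin n))

    -- An equality of lists including their order, since the toggle uses the first slot.
    slots-cong : ∀ S α α′ → (∀ q → α q ≡ α′ q) → slots S α ≡ slots S α′
    slots-cong S α α′ eq = List.filter-≐ (slot? S α) (slot? S α′)
      (slot-resp eq , slot-resp (sym ∘ eq)) (List.cartesianProduct boxes (List.allFin n))

    ∈-slots⁺ : ∀ S α {p i} → Slot S α p i → (p , i) ∈ˡ slots S α
    ∈-slots⁺ S α {p} {i} s =
      ∈ˡ.∈-filter⁺ (slot? S α) (∈ˡ.∈-cartesianProduct⁺ (∈-boxes p) (∈ˡ.∈-allFin i)) s

    ∈-slots⁻ : ∀ S α {p i} → (p , i) ∈ˡ slots S α → Slot S α p i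
    ∈-slots⁻ S α p∈ =
      proj₂ (∈ˡ.∈-filter⁻ (slot? S α) {xs = List.cartesianProduct boxes (List.allFin n)} p∈)

  slots≡[] : ∀ S α → slots S α ≡ [] → ∀ p i → ¬ Slot S α p i
  slots≡[] S α eq p i s with () ← subst ((p , i) ∈ˡ_) eq (∈-slots⁺ S α s)

  -- Treats insertion and deletion of `i` at once: `F′` has at most the extra entry `i` in `p` and
  -- keeps every anchor. Deletions are harmless for all conditions, so what needs an argument is the
  -- presence of `i` in `p`.
  anchored-slot : ∀ {S F F′ α p i} → Anchored F α → Slot S α p i →
    (∀ q {x} → x ∈ F′ q → x ∈ F q ⊎ (q ≡ p × x ≡ i)) → (∀ q → α q ∈ F′ q) → Anchored F′ α
  anchored-slot {F = F} {F′} {α} {p} {i} A s F′⊆ α∈ = record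
    { anchors  = λ q → α∈ q , λ y y∈ → bound q (F′⊆ q y∈)
    ; distinct = λ q r same x x∈q x∈r → dist q r same (F′⊆ q x∈q) (F′⊆ r x∈r)
    ; rows     = λ q x x∈ → decr q (F′⊆ q x∈)
    ; triple   = triple A
    ; low      = λ q r same x x∈ → lowest′ q r same (F′⊆ q x∈)
    ; left     = left A
    }
    where
    bound : ∀ q {x} → x ∈ F q ⊎ (q ≡ p × x ≡ i) → x Fin.≤ α q
    bound q (inj₁ x∈)            = ≤anchor A q x∈
    bound q (inj₂ (refl , refl)) = ℕ.<⇒≤ (below s)
    decr : ∀ q {x} → x ∈ F q ⊎ (q ≡ p × x ≡ i) → Fits α q x
    decr q (inj₁ x∈)            = rows A q _ x∈
    decr q (inj₂ (refl , refl)) = fits s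
    -- No other box of the column contains `i`. It would be free there by `fresh`, so `lowest` would
    -- give `p` the smaller anchor; but then (S.4) would have put `i` into `p`, where it fits.
    only-p : ∀ q → SameColumn p q → i ∈ F q → p ≡ q
    only-p q same i∈ with α p Fin.≟ α q
    ... | yes eq = distinct A p q same (α p) (anchor∈ A p) (subst (_∈ F q) (sym eq) (anchor∈ A q))
    ... | no  ≢q = contradiction (fits s) (low A q p (sym same) i i∈ (below s)
      (Fin.≤∧≢⇒< (lowest s q same (Fin.≤∧≢⇒< (≤anchor A q i∈) (fresh s q same ∘ sym)) (rows A q i i∈))
                 ≢q))
    dist : ∀ q r → SameColumn q r → ∀ {x} →
           x ∈ F q ⊎ (q ≡ p × x ≡ i) → x ∈ F r ⊎ (r ≡ p × x ≡ i) → q ≡ r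
    dist q r same (inj₁ x∈q)            (inj₁ x∈r)        = distinct A q r same _ x∈q x∈r
    dist q r same (inj₁ x∈q)            (inj₂ (refl , refl)) = sym (only-p q (sym same) x∈q)
    dist q r same (inj₂ (refl , refl)) (inj₁ x∈r)        = only-p r same x∈r
    dist q r same (inj₂ (refl , _))    (inj₂ (refl , _)) = refl
    lowest′ : ∀ q r → SameColumn q r → ∀ {x} → x ∈ F q ⊎ (q ≡ p × x ≡ i) →
              x Fin.< α r → α r Fin.< α q → ¬ Fits α r x
    lowest′ q r same (inj₁ x∈)            x<r r<q fit = low A q r same _ x∈ x<r r<q fit
    lowest′ q r same (inj₂ (refl , refl)) x<r r<q fit = ℕ.<⇒≱ r<q (lowest s r same x<r fit)

-- Fillings without a slot

Decreasing : Subset n → WeakComposition n → Set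
Decreasing S a = Within S a × (∀ i j → i ∈ S → i Fin.< j → lookup a j ≤ lookup a i)

decreasing? : (S : Subset n) → Decidable (Decreasing S)
decreasing? S a = within? S a ×-dec Fin.all? λ i → Fin.all? λ j →
  (i ∈? S) →-dec (i Fin.<? j) →-dec (lookup a j ℕ.≤? lookup a i)

module _ {n : ℕ} {a : WeakComposition n} {S : Subset n} {F : Box a → Subset n} {α : Box a → Fin n}
  (A : Anchored F α) (F⊆S : ∀ p x → x ∈ F p → x ∈ S) (noSlot : ∀ p i → ¬ Slot S α p i) where

  open Anchored A

  private
    column< : (p : Box a) → column p < lookup a (row p)
    column< p = Fin.toℕ<n (Box.col p)

  -- Removes the condition `lowest`: among the boxes of the column that could take `i`, one with the
  -- smallest anchor is a slot. Descent on the anchor finds it.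
  noCandidate : ∀ {i} → i ∈ S → ∀ p → (∀ q → SameColumn p q → α q ≢ i) → i Fin.< α p → ¬ Fits α p i
  noCandidate {i} i∈S p = go p (Fin.<-wellFounded (α p))
    where
    go : ∀ p → Acc Fin._<_ (α p) → (∀ q → SameColumn p q → α q ≢ i) → i Fin.< α p → ¬ Fits α p i
    go p (acc rec) fresh i<p fit = noSlot p i (slot i∈S i<p fit fresh λ q same i<q fit′ →
      ℕ.≮⇒≥ λ q<p → go q (rec q<p) (λ r same′ → fresh r (trans same same′)) i<q fit′)

  -- A free entry occupies a place that could take it, and by (S.1) it is not an anchor in its
  -- column.
  noFree : ∀ p x → x ∈ F p → x ≡ α p
  noFree p x x∈ with x Fin.≟ α p
  ... | yes x≡ = x≡
  ... | no  x≢ = contradiction (rows p x x∈) (noCandidate (F⊆S p x x∈) p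
    (λ q same q≡x → x≢ (trans (sym q≡x) (cong α
      (sym (distinct p q same x x∈ (subst (_∈ F q) q≡x (anchor∈ q)))))))
    (Fin.≤∧≢⇒< (≤anchor p x∈) x≢))

  -- Induction over columns, and inside a column over rows from below. If the anchor `s` of `p`
  -- differs from its row, then `s` is smaller, because the box `q` on the left has its row as
  -- anchor. The contradiction depends on how far row `s` reaches.
  anchor≡row : ∀ k p → column p ≡ k → α p ≡ row p
  anchor≡row zero    p eq = left p eq
  anchor≡row (suc k) p eq = go p (Fin.<-wellFounded (row p)) eq
    where
    go : ∀ p → Acc Fin._<_ (row p) → column p ≡ suc k → α p ≡ row p
    go p (acc rec) eq with α p Fin.≟ row p
    ... | yes α≡ = α≡
    ... | no  α≢ = ⊥-elim absurd
      where
      k<p : k < lookup a (row p)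
      k<p = ℕ.≤-trans (ℕ.≤-reflexive (sym eq)) (ℕ.<⇒≤ (column< p))
      q : Box a
      q = box (row p) (fromℕ< k<p)
      column-q : column q ≡ k
      column-q = Fin.toℕ-fromℕ< k<p
      right : ImmediatelyRightOf p q
      right = refl , trans eq (cong suc (sym column-q))
      αq : α q ≡ row p
      αq = anchor≡row k q column-q
      s = α p
      s<p : s Fin.< row p
      s<p = Fin.≤∧≢⇒< (subst (s Fin.≤_) αq (rows q (α q) (anchor∈ q) p right)) α≢
      absurd : ⊥
      absurd with k ℕ.<? lookup a s | lookup a s ℕ.<? lookup a (row p)
      -- Row `s` meets the column of `q` but is shorter than the row of `p`. Its box `r` there has
      -- anchor `s`, and (S.3) would require `s < s` or `row p < s`.
      ... | yes k<s | yes s-shorter with triple p q r right (inj₂ (s<p , s-shorter))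
                                           (inj₂ (s<p , trans column-r (sym column-q)))
        where
        r : Box a
        r = box s (fromℕ< k<s)
        column-r : column r ≡ k
        column-r = Fin.toℕ-fromℕ< k<s
      ...   | inj₁ r<s = Fin.<-irrefl (anchor≡row k _ (Fin.toℕ-fromℕ< k<s)) r<s
      ...   | inj₂ q<r = Fin.<-asym s<p (subst₂ Fin._<_ αq (anchor≡row k _ (Fin.toℕ-fromℕ< k<s)) q<r)
      -- Row `s` also reaches the column of `p`, where its box has anchor `s` by the inner
      -- induction. Then `s` occurs twice in that column.
      absurd | yes k<s | no s-longer = Fin.<-irrefl (cong row (sym p≡r)) s<p
        where
        k′<s : suc k < lookup a s
        k′<s = ℕ.≤-trans (subst (_< lookup a (row p)) eq (column< p)) (ℕ.≮⇒≥ s-longer)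
        r : Box a
        r = box s (fromℕ< k′<s)
        αr : α r ≡ s
        αr = go r (rec s<p) (Fin.toℕ-fromℕ< k′<s)
        p≡r : p ≡ r
        p≡r = distinct p r (trans eq (sym (Fin.toℕ-fromℕ< k′<s))) s (anchor∈ p)
                (subst (_∈ F r) αr (anchor∈ r))
      -- Row `s` misses the column of `q`, whose anchors are its row indices, so `s` is not among
      -- them. As `s` is the anchor right of `q` and lies below `α q`, it could be added to `q`.
      absurd | no k≮s | _ = noCandidate (F⊆S p s (anchor∈ p)) q
        (λ r same r≡s → k≮s (subst₂ _<_ (trans (sym same) column-q)
          (cong (lookup a) (trans (sym (anchor≡row k r (trans (sym same) column-q))) r≡s))
          (column< r)))
        (subst (s Fin.<_) (sym αq) s<p)
        (λ r (r≡ , c≡) → Fin.≤-reflexive (cong α (box-ext r≡ (trans c≡ (sym (proj₂ right))))))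

  box≡singleton : ∀ p → F p ≡ ⁅ row p ⁆
  box≡singleton p = ⊆-antisym
    (λ {x} x∈ → subst (_∈ ⁅ row p ⁆) (sym (trans (noFree p x x∈) α≡)) (x∈⁅x⁆ (row p)))
    (λ x∈ → subst (_∈ F p) (trans α≡ (sym (x∈⁅y⁆⇒x≡y (row p) x∈))) (anchor∈ p))
    where
    α≡ = anchor≡row (column p) p refl

  noSlot⇒decreasing : Decreasing S a
  noSlot⇒decreasing = indexed , λ i j i∈S i<j → ℕ.≮⇒≥ (shorter i j i∈S i<j)
    where
    indexed : Within S a
    indexed i ≢0 = F⊆S p i (subst (_∈ F p) (anchor≡row _ p refl) (anchor∈ p))
      where
      p : Box a
      p = box i (fromℕ< (ℕ.n≢0⇒n>0 ≢0))
    shorter : ∀ i j → i ∈ S → i Fin.< j → ¬ lookup a i < lookup a j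
    -- Here `p` is the last box of row `j`. Nothing stands on its right, so `i` fits; and row `i` is
    -- too short to reach this column, so `i` is not an anchor in it.
    shorter i j i∈S i<j ai<aj = noCandidate i∈S p
      (λ q same q≡i → ℕ.<⇒≱ (column< q) (subst₂ _≤_
        (cong (lookup a) (trans (sym q≡i) (anchor≡row _ q refl))) same ai≤p))
      (subst (i Fin.<_) (sym (anchor≡row _ p refl)) i<j)
      (λ r (r≡ , c≡) → contradiction (column< r)
        (ℕ.<-irrefl (trans c≡ (trans suc-p (cong (lookup a) (sym r≡))))))
      where
      instance
        aj≢0 : ℕ.NonZero (lookup a j)
        aj≢0 = ℕ.>-nonZero (ℕ.≤-<-trans z≤n ai<aj)
      pred< : ℕ.pred (lookup a j) < lookup a j
      pred< = ℕ.≤-reflexive (ℕ.suc-pred (lookup a j))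
      p : Box a
      p = box j (fromℕ< pred<)
      suc-p : suc (column p) ≡ lookup a j
      suc-p = trans (cong suc (Fin.toℕ-fromℕ< pred<)) (ℕ.suc-pred (lookup a j))
      ai≤p : lookup a i ≤ column p
      ai≤p = ℕ.s≤s⁻¹ (ℕ.≤-trans ai<aj (ℕ.≤-reflexive (sym suc-p)))

-- The filling with constant rows

rowFilling : (a : WeakComposition n) → Filling a
rowFilling a = VecAll.lookup⁻ λ i → Vec.replicate (lookup a i) ⁅ i ⁆

lookup⁺-lookup⁻ : (P : A → Set) (v : Vec A m) (f : ∀ i → P (lookup v i)) → ∀ i →
                  VecAll.lookup⁺ (VecAll.lookup⁻ {P = P} {xs = v} f) i ≡ f i
lookup⁺-lookup⁻ P (_ ∷ v) f zero    = refl
lookup⁺-lookup⁻ P (_ ∷ v) f (suc i) = lookup⁺-lookup⁻ P v (f ∘ suc) i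

rowFilling-box : (a : WeakComposition n) (p : Box a) → rowFilling a ⟦ p ⟧ ≡ ⁅ row p ⁆
rowFilling-box a (box i c) = trans
  (cong (λ R → lookup R c)
        (lookup⁺-lookup⁻ (Vec (Subset _)) a (λ i → Vec.replicate (lookup a i) ⁅ i ⁆) i))
  (Vec.lookup-replicate c ⁅ i ⁆)

module _ {n : ℕ} (a : WeakComposition n) where

  ∈-rowFilling : ∀ p {x} → x ∈ rowFilling a ⟦ p ⟧ → x ≡ row p
  ∈-rowFilling p {x} x∈ = x∈⁅y⁆⇒x≡y (row p) (subst (x ∈_) (rowFilling-box a p) x∈)

  rowFilling-anchored : Anchored (rowFilling a ⟦_⟧) row
  rowFilling-anchored = record
    { anchors  = λ p → subst (row p ∈_) (sym (rowFilling-box a p)) (x∈⁅x⁆ (row p)) ,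
                       λ y y∈ → Fin.≤-reflexive (∈-rowFilling p y∈)
    ; distinct = λ p q same x x∈p x∈q →
        box-ext (trans (sym (∈-rowFilling p x∈p)) (∈-rowFilling q x∈q)) same
    ; rows     = λ p x x∈ q (q≡p , _) → Fin.≤-reflexive (trans q≡p (sym (∈-rowFilling p x∈)))
    -- Both α and β are the index of their common row, so a box above gives a larger γ and a box
    -- below a smaller one.
    ; triple   = λ { p q r (p≡q , _) _ (inj₁ (p<r , _)) → inj₂ (subst (Fin._< row r) p≡q p<r)
                   ; p q r (p≡q , _) _ (inj₂ (r<q , _)) → inj₁ (subst (row r Fin.<_) (sym p≡q) r<q) }
    ; low      = λ p q _ x x∈ x<q q<p _ →
        Fin.<-asym x<q (subst (row q Fin.<_) (sym (∈-rowFilling p x∈)) q<p)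
    ; left     = λ _ _ → refl
    }

  -- A candidate `i` for `p` is the index of a lower row, which is at least as long. That row meets
  -- the column of `p` in a box with anchor `i`, against `fresh`.
  rowFilling-noSlot : ∀ {S} → Decreasing S a → ∀ p i → ¬ Slot S row p i
  rowFilling-noSlot (_ , dec) p i s = Slot.fresh s q (sym (Fin.toℕ-fromℕ< c<i)) refl
    where
    c<i : column p < lookup a i
    c<i = ℕ.≤-trans (Fin.toℕ<n (Box.col p)) (dec i (row p) (Slot.allowed s) (Slot.below s))
    q : Box a
    q = box i (fromℕ< c<i)

  rowFilling-entries : ∀ {S} → Within S a → Entries S (rowFilling a)
  rowFilling-entries {S} h p x x∈ =
    subst (_∈ S) (sym (∈-rowFilling p x∈))
      (h (row p) (λ ≡0 → contradiction (subst (column p <_) ≡0 (Fin.toℕ<n (Box.col p))) λ ()))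

  rowFilling-excess : excess (rowFilling a) ≡ 0
  rowFilling-excess = ℕ.m≤n⇒m∸n≡0 (total≤size ∣_∣ (rowFilling a) λ p →
    ℕ.≤-reflexive (trans (cong ∣_∣ (rowFilling-box a p)) (∣⁅x⁆∣≡1 (row p))))

-- The involution on fillings

toggleFirst : {a : WeakComposition n} → List (Box a × Fin n) → Filling a → Filling a
toggleFirst []            T = T
toggleFirst ((p , i) ∷ _) T = adjust (flip i) T p

module _ {n : ℕ} (S : Subset n) {a : WeakComposition n} where

  slotsOf : Filling a → List (Box a × Fin n)
  slotsOf T = slots S (anchorsOf (T ⟦_⟧))

  toggleFilling : Filling a → Filling a
  toggleFilling T = toggleFirst (slotsOf T) T

  Togglable : Filling a → Set
  Togglable T = Within S (weight T) × slotsOf T ≢ []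

  togglable? : Decidable Togglable
  togglable? T = within? S (weight T) ×-dec ¬? (empty? (slotsOf T))
    where
    empty? : (xs : List A) → Dec (xs ≡ [])
    empty? []      = yes refl
    empty? (_ ∷ _) = no λ ()

  semistandard-size : ∀ {T : Filling a} → Semistandard (T ⟦_⟧) → size a ≤ sum (List.map ∣_∣ (contents T))
  semistandard-size {T} ss = size≤total ∣_∣ T λ p → nonempty⇒1≤∣∣ (Semistandard.nonempty ss p)

  adjust-slot : ∀ {T : Filling a} {p i α} → Anchored (T ⟦_⟧) α → Slot S α p i →
                Anchored (adjust (flip i) T p ⟦_⟧) α
  adjust-slot {T} {p} {i} {α} A s = anchored-slot A s sub anc
    where
    open Anchored A
    sub : ∀ q {x} → x ∈ adjust (flip i) T p ⟦ q ⟧ → x ∈ T ⟦ q ⟧ ⊎ (q ≡ p × x ≡ i)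
    sub q {x} x∈ with q ≟ᵇ p
    ... | no  q≢p = inj₁ (subst (x ∈_) (at-adjust-≢ (flip i) T q≢p) x∈)
    ... | yes refl with flip-∈⁻ i (T ⟦ p ⟧) (subst (x ∈_) (at-adjust (flip i) T p) x∈)
    ...   | inj₁ x∈T = inj₁ x∈T
    ...   | inj₂ x≡i = inj₂ (refl , x≡i)
    anc : ∀ q → α q ∈ adjust (flip i) T p ⟦ q ⟧
    anc q with q ≟ᵇ p
    ... | no  q≢p  = subst (α q ∈_) (sym (at-adjust-≢ (flip i) T q≢p)) (anchor∈ q)
    ... | yes refl = subst (α q ∈_) (sym (at-adjust (flip i) T p))
      (flip-∈⁺ i (T ⟦ p ⟧) (anchor∈ q) (Slot.fresh s p refl))

  adjust-entries : ∀ {T : Filling a} {p i} → i ∈ S → Entries S T → Entries S (adjust (flip i) T p)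
  adjust-entries {T} {p} {i} i∈S h q x x∈ with q ≟ᵇ p
  ... | no  q≢p = h q x (subst (x ∈_) (at-adjust-≢ (flip i) T q≢p) x∈)
  ... | yes refl with flip-∈⁻ i (T ⟦ p ⟧) (subst (x ∈_) (at-adjust (flip i) T p) x∈)
  ...   | inj₁ x∈T  = h q x x∈T
  ...   | inj₂ refl = i∈S

  toggle-involution : ∀ {T : Filling a} → Semistandard (T ⟦_⟧) → Togglable T →
    (Semistandard (toggleFilling T ⟦_⟧) × Togglable (toggleFilling T)) ×
    toggleFilling (toggleFilling T) ≡ T × Adjacent (excess T) (excess (toggleFilling T))
  toggle-involution {T} ss (h , ≢[]) with slotsOf T in eq
  ... | []           = contradiction refl ≢[]
  ... | (p , i) ∷ ss′ =
    (ss″ , within′ , λ eq″ → ≢[] (trans (sym slots′) eq″)) ,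
    trans (cong (λ s → toggleFirst s T′) slots′) (adjust-adjust (flip i) (flip-flip i) T p) ,
    adjacent-∸ (semistandard-size {T} ss) (semistandard-size {T′} ss″)
      (total-adjust ∣_∣ (flip i) T p (flip-∣∣ i (T ⟦ p ⟧)))
    where
    T′ = adjust (flip i) T p
    anch = semistandard⇒anchored ss
    s : Slot S (anchorsOf (T ⟦_⟧)) p i
    s = ∈-slots⁻ S (anchorsOf (T ⟦_⟧)) (subst ((p , i) ∈ˡ_) (sym eq) (here refl))
    A′ : Anchored (T′ ⟦_⟧) (anchorsOf (T ⟦_⟧))
    A′ = adjust-slot {T} anch s
    ss″ : Semistandard (T′ ⟦_⟧)
    ss″ = anchored⇒semistandard A′
    -- The anchors of `T` are still those of `T′`, so both fillings have the same first slot and the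
    -- second toggle undoes the first.
    slots′ : slotsOf T′ ≡ (p , i) ∷ ss′
    slots′ = trans (slots-cong S (anchorsOf (T′ ⟦_⟧)) (anchorsOf (T ⟦_⟧)) (anchored⇒anchorsOf A′)) eq
    within′ : Within S (weight T′)
    within′ = entries⇒within {T = T′}
      (adjust-entries {T} {p} (Slot.allowed s) (within⇒entries {T = T} h))

  untogglable⇒decreasing : ∀ {T : Filling a} → Semistandard (T ⟦_⟧) → Within S (weight T) →
    ¬ Togglable T → Decreasing S a × T ≡ rowFilling a
  untogglable⇒decreasing {T} ss h ¬t with slotsOf T in eq
  ... | _ ∷ _ = contradiction (h , λ ()) ¬t
  ... | []    = noSlot⇒decreasing anch entries (slots≡[] S (anchorsOf (T ⟦_⟧)) eq) ,
                at-injective λ p → trans (box≡singleton anch entries (slots≡[] S (anchorsOf (T ⟦_⟧)) eq) p)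
                                         (sym (rowFilling-box a p))
    where
    anch = semistandard⇒anchored ss
    entries = within⇒entries {T = T} h

evaluateOn-lascouxAtom : (S : Subset n) (a : WeakComposition n) →
                         evaluateOn S (lascouxAtom a) ≡ 𝟙 (decreasing? S a)
evaluateOn-lascouxAtom {n} S a = trans (evaluate-monomials _ excess weight (elements (𝔄SSF a)))
  (sum≡ (decreasing? S a))
  where
  f : Filling a → ℤ
  f T = signed S (excess T) (weight T)
  f-¬within : ∀ T → ¬ Within S (weight T) → f T ≡ 0ℤ
  f-¬within T = signed-¬within (excess T) (weight T)
  inv : ∀ {T} → Semistandard (T ⟦_⟧) → Togglable S T →
    (Semistandard (toggleFilling S T ⟦_⟧) × Togglable S (toggleFilling S T)) ×
    toggleFilling S (toggleFilling S T) ≡ T × f (toggleFilling S T) ≡ ℤ.- f T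
  inv {T} ss t =
    let ((ss′ , t′) , eq , adj) = toggle-involution S {T = T} ss t
    in (ss′ , t′) , eq ,
       signed-adjacent (weight T) (weight (toggleFilling S T)) (proj₁ t) (proj₁ t′) adj
  rows-anchored : Anchored (rowFilling a ⟦_⟧) row
  rows-anchored = rowFilling-anchored a
  noSlots : {B : Set} (xs : List B) → (∀ {x} → ¬ x ∈ˡ xs) → xs ≡ []
  noSlots []       _  = refl
  noSlots (x ∷ xs) ∉  = contradiction (here refl) ∉
  rows-untogglable : Decreasing S a → ¬ Togglable S (rowFilling a)
  rows-untogglable dec (_ , ≢[]) = ≢[] (noSlots (slotsOf S (rowFilling a)) λ { {p , i} s →
    rowFilling-noSlot a dec p i
      (slot-resp {α = anchorsOf (rowFilling a ⟦_⟧)} {row} (anchored⇒anchorsOf rows-anchored)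
        (∈-slots⁻ S (anchorsOf (rowFilling a ⟦_⟧)) s)) })
  sum≡ : Dec (Decreasing S a) → ∑ (elements (𝔄SSF a)) f ≡ 𝟙 (decreasing? S a)
  sum≡ (no ¬dec) = trans
    (∑-cancel-zero (𝔄SSF a) (togglable? S) f (toggleFilling S) inv
      λ {T} ss ¬t → f-¬within T λ h → ¬dec (proj₁ (untogglable⇒decreasing S {T = T} ss h ¬t)))
    (sym (𝟙-no (decreasing? S a) ¬dec))
  sum≡ (yes dec) = trans
    (∑-cancel-single (𝔄SSF a) (togglable? S) f (toggleFilling S) inv
      {rowFilling a} (anchored⇒semistandard rows-anchored) (rows-untogglable dec)
      (λ {T} ss ¬t T≢ → f-¬within T λ h → T≢ (proj₂ (untogglable⇒decreasing S {T = T} ss h ¬t))))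
    (trans (signed-0 (weight (rowFilling a)) (rowFilling-excess a)
             (entries⇒within {T = rowFilling a} (rowFilling-entries a (proj₁ dec))))
           (sym (𝟙-yes (decreasing? S a) dec)))

-- Summing over index sets and slides

decreasing-tail : ∀ {s x} → Decreasing (s ∷ S) (x ∷ a) → Decreasing S a
decreasing-tail (h , d) =
  within-tail h , λ i j i∈S i<j → d (suc i) (suc j) (Vec.there i∈S) (s≤s i<j)

-- A zero part at an element of `S` bounds all later parts by 0, which is what `stop` asks for.
decreasing⇒initial : (S : Subset n) (a : WeakComposition n) → Decreasing S a → Initial S a
decreasing⇒initial []          []          d = []
decreasing⇒initial (true ∷ S)  (suc k ∷ a) d = part (decreasing⇒initial S a (decreasing-tail d))
decreasing⇒initial (false ∷ S) (suc k ∷ a) d with () ← within-head (proj₁ d) (λ ())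
decreasing⇒initial (true ∷ S)  (0 ∷ a)     d =
  stop (VecAll.lookup⁻ λ j → ℕ.n≤0⇒n≡0 (proj₂ d zero (suc j) Vec.here (s≤s z≤n)))
decreasing⇒initial (false ∷ S) (0 ∷ a)     d = skip (decreasing⇒initial S a (decreasing-tail d))

∈-⁺ : (a : WeakComposition n) (i : Fin n) → lookup a i ≢ 0 → lookup a i ∈ˡ a ⁺
∈-⁺ a i = ∈ˡ.∈-filter⁺ (λ x → ¬? (x ℕ.≟ 0)) (lookup-∈-toList a i)

⁺-∈ : ∀ (a : WeakComposition n) {x} → x ∈ˡ a ⁺ → ∃ λ i → lookup a i ≡ x
⁺-∈ a = ∈-toList⇒lookup a ∘ proj₁ ∘ ∈ˡ.∈-filter⁻ (λ x → ¬? (x ℕ.≟ 0)) {xs = toList a}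

linked-∷ : ∀ {x ys} → All (x ≥_) ys → WeaklyDecreasing ys → WeaklyDecreasing (x ∷ ys)
linked-∷ []       []  = [-]
linked-∷ (x≥y ∷ _) l  = x≥y ∷ l

linked-All : ∀ {x ys} → WeaklyDecreasing (x ∷ ys) → All (x ≥_) ys
linked-All l = AllPairs.head (Linked.Linked⇒AllPairs (λ x≥y y≥z → ℕ.≤-trans y≥z x≥y) l)

decreasing⇒weaklyDecreasing : (S : Subset n) (a : WeakComposition n) →
                              Decreasing S a → WeaklyDecreasing (a ⁺)
decreasing⇒weaklyDecreasing []          []          d = []
decreasing⇒weaklyDecreasing (s ∷ S)     (0 ∷ a)     d =
  decreasing⇒weaklyDecreasing S a (decreasing-tail d)
decreasing⇒weaklyDecreasing (false ∷ S) (suc k ∷ a) d with () ← within-head (proj₁ d) (λ ())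
decreasing⇒weaklyDecreasing (true ∷ S)  (suc k ∷ a) d = linked-∷
  (All.tabulate λ x∈ → let (j , eq) = ⁺-∈ a x∈ in
    ℕ.≤-trans (ℕ.≤-reflexive (sym eq)) (proj₂ d zero (suc j) Vec.here (s≤s z≤n)))
  (decreasing⇒weaklyDecreasing S a (decreasing-tail d))

zero-lookup : Zero a → ∀ i → lookup a i ≡ 0
zero-lookup = VecAll.lookup⁺

initial⇒decreasing : Initial S a → WeaklyDecreasing (a ⁺) → Decreasing S a
initial⇒decreasing i l = initial⇒within i , bounded i l
  where
  bounded : ∀ {n} {S : Subset n} {a} → Initial S a → WeaklyDecreasing (a ⁺) →
            ∀ i j → i ∈ S → i Fin.< j → lookup a j ≤ lookup a i
  bounded {a = suc k ∷ a} (part h) l zero    (suc j) _ _ with lookup a j ℕ.≟ 0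
  ... | yes ≡0 = subst (_≤ suc k) (sym ≡0) z≤n
  ... | no  ≢0 = All.lookup (linked-All l) (∈-⁺ a j ≢0)
  bounded (part h) l (suc i) (suc j) i∈ (s≤s i<j) = bounded h (Linked.tail l) i j (drop-there i∈) i<j
  bounded (skip h) l (suc i) (suc j) i∈ (s≤s i<j) = bounded h l i j (drop-there i∈) i<j
  bounded (stop z) l i       (suc j) _  _         = subst (_≤ _) (sym (zero-lookup z j)) z≤n

weaklyDecreasing? : (xs : List ℕ) → Dec (WeaklyDecreasing xs)
weaklyDecreasing? = Linked.linked? ℕ._≥?_

-- The factor depends neither on `S` nor on the zeros of `a`. The former lets it pass through a sum
-- over subsets, the latter through a sum over slides.
evaluateOn-lascouxAtom-kaon : (S : Subset n) (a : WeakComposition n) →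
  evaluateOn S (lascouxAtom a) ≡ 𝟙 (weaklyDecreasing? (a ⁺)) ℤ.* evaluateOn S (kaon a)
evaluateOn-lascouxAtom-kaon S a = begin
  evaluateOn S (lascouxAtom a)                              ≡⟨ evaluateOn-lascouxAtom S a ⟩
  𝟙 (decreasing? S a)                                       ≡⟨ product (weaklyDecreasing? (a ⁺)) ⟩
  𝟙 (weaklyDecreasing? (a ⁺)) ℤ.* 𝟙 (initial? S a)          ≡⟨ cong (𝟙 (weaklyDecreasing? (a ⁺)) ℤ.*_) (evaluateOn-kaon S a) ⟨
  𝟙 (weaklyDecreasing? (a ⁺)) ℤ.* evaluateOn S (kaon a)     ∎
  where
  product : (d : Dec (WeaklyDecreasing (a ⁺))) → 𝟙 (decreasing? S a) ≡ 𝟙 d ℤ.* 𝟙 (initial? S a)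
  product (yes l) = trans
    (𝟙-cong (decreasing? S a) (initial? S a) (decreasing⇒initial S a) (λ i → initial⇒decreasing i l))
    (sym (ℤ.*-identityˡ _))
  product (no ¬l) = 𝟙-no (decreasing? S a) (¬l ∘ decreasing⇒weaklyDecreasing S a)

-- Chosen so that the functional Σ_S ω(S) · evaluateOn S takes the value 1 on every kaon.
ω : Subset n → ℤ
ω []          = 1ℤ
ω (true ∷ S)  = ω S
ω (false ∷ S) = ω S ℤ.- 𝟙 (¬? (nonempty? S))

∑-subsets : (f : Subset (suc n) → ℤ) →
  ∑ (subsets (suc n)) f ≡ ∑ (subsets n) (f ∘ (false ∷_)) ℤ.+ ∑ (subsets n) (f ∘ (true ∷_))
∑-subsets {n} f = trans (∑-cartesianProductWith _∷_ (false ∷ true ∷ []) (subsets n) f)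
  (cong (λ s → ∑ (subsets n) (f ∘ (false ∷_)) ℤ.+ s) (ℤ.+-identityʳ _))

-- In closed form, `ω S` is 1 minus the number of positions behind the last element of `S`, so `ω`
-- of the empty set is 1 - n. In the induction, subsets with and without the first position each
-- contribute 1, and the correction subtracts 1 once, at the empty set.
∑-ω : ∀ n → ∑ (subsets n) ω ≡ 1ℤ
∑-ω zero    = refl
∑-ω (suc n) = begin
  ∑ (subsets (suc n)) ω
    ≡⟨ ∑-subsets {n} ω ⟩
  ∑ (subsets n) (λ S → ω S ℤ.- 𝟙 (¬? (nonempty? S))) ℤ.+ ∑ (subsets n) ω
    ≡⟨ cong (ℤ._+ ∑ (subsets n) ω) (∑-+ (subsets n) ω _) ⟩
  ∑ (subsets n) ω ℤ.+ ∑ (subsets n) (λ S → ℤ.- 𝟙 (¬? (nonempty? S))) ℤ.+ ∑ (subsets n) ω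
    ≡⟨ cong₂ (λ s t → s ℤ.+ t ℤ.+ s) (∑-ω n) (trans
         (∑-single {xs = subsets n} (λ S → ℤ.- 𝟙 (¬? (nonempty? S))) (subsets-unique n)
           (subsets-complete Subset.⊥) (λ {S} _ S≢∅ → cong ℤ.-_
             (𝟙-no (¬? (nonempty? S)) (S≢∅ ∘ Empty-unique))))
         (cong ℤ.-_ (𝟙-yes (¬? (nonempty? (Subset.⊥ {n}))) λ (_ , x∈) → ∉⊥ x∈))) ⟩
  1ℤ ∎

zero⇒initial : (S : Subset n) (a : WeakComposition n) → Zero a → Initial S a
zero⇒initial []          []      []         = []
zero⇒initial (true ∷ S)  (_ ∷ a) (refl ∷ z) = stop z
zero⇒initial (false ∷ S) (_ ∷ a) (refl ∷ z) = skip (zero⇒initial S a z)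

-- Up to the last part of `a` the subset is forced, and behind it every choice counts. The forced
-- positions do not change the weight, so the sum reduces to `∑-ω` for the remaining ones.
∑-ω-initial : (a : WeakComposition n) → ∑ (subsets n) (λ S → ω S ℤ.* 𝟙 (initial? S a)) ≡ 1ℤ
∑-ω-initial []              = refl
∑-ω-initial {suc n} (suc k ∷ a) = begin
  ∑ (subsets (suc n)) (λ S → ω S ℤ.* 𝟙 (initial? S (suc k ∷ a)))
    ≡⟨ ∑-subsets {n} _ ⟩
  ∑ (subsets n) (λ S → ω (false ∷ S) ℤ.* 0ℤ) ℤ.+
  ∑ (subsets n) (λ S → ω S ℤ.* 𝟙 (initial? (true ∷ S) (suc k ∷ a)))
    ≡⟨ cong₂ ℤ._+_ (∑-zero (subsets n) (λ {S} _ → ℤ.*-zeroʳ (ω (false ∷ S))))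
         (∑-cong (subsets n) (λ {S} _ → cong (ω S ℤ.*_)
           (𝟙-cong (initial? (true ∷ S) (suc k ∷ a)) (initial? S a) (λ { (part h) → h }) part))) ⟩
  0ℤ ℤ.+ ∑ (subsets n) (λ S → ω S ℤ.* 𝟙 (initial? S a))
    ≡⟨ trans (ℤ.+-identityˡ _) (∑-ω-initial a) ⟩
  1ℤ ∎
∑-ω-initial {suc n} (0 ∷ a) with zero? a
... | yes z = trans
  (∑-cong (subsets (suc n)) (λ {S} _ → trans
    (cong (ω S ℤ.*_) (𝟙-yes (initial? S (0 ∷ a)) (zero⇒initial S (0 ∷ a) (refl ∷ z))))
    (ℤ.*-identityʳ (ω S))))
  (∑-ω (suc n))
... | no ¬z = begin
  ∑ (subsets (suc n)) (λ S → ω S ℤ.* 𝟙 (initial? S (0 ∷ a)))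
    ≡⟨ ∑-subsets {n} _ ⟩
  ∑ (subsets n) (λ S → ω (false ∷ S) ℤ.* 𝟙 (initial? (false ∷ S) (0 ∷ a))) ℤ.+
  ∑ (subsets n) (λ S → ω S ℤ.* 𝟙 (initial? (true ∷ S) (0 ∷ a)))
    ≡⟨ cong₂ ℤ._+_
         (∑-cong (subsets n) (λ {S} _ → trans
           (cong (ω (false ∷ S) ℤ.*_)
             (𝟙-cong (initial? (false ∷ S) (0 ∷ a)) (initial? S a) (λ { (skip h) → h }) skip))
           (nonempty S (nonempty? S) (initial? S a))))
         (∑-zero (subsets n) (λ {S} _ → trans
           (cong (ω S ℤ.*_) (𝟙-no (initial? (true ∷ S) (0 ∷ a)) λ { (stop z) → ¬z z }))
           (ℤ.*-zeroʳ (ω S)))) ⟩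
  ∑ (subsets n) (λ S → ω S ℤ.* 𝟙 (initial? S a)) ℤ.+ 0ℤ
    ≡⟨ trans (ℤ.+-identityʳ _) (∑-ω-initial a) ⟩
  1ℤ ∎
  where
  -- The correction in `ω (false ∷ S)` would need an empty `S`, but `S` contains the support of `a`,
  -- which is nonzero here.
  nonempty : ∀ S (d : Dec (Nonempty S)) (e : Dec (Initial S a)) →
             (ω S ℤ.- 𝟙 (¬? d)) ℤ.* 𝟙 e ≡ ω S ℤ.* 𝟙 e
  nonempty S (yes _) e       = cong (ℤ._* 𝟙 e) (ℤ.+-identityʳ (ω S))
  nonempty S (no _)  (no _)  = trans (ℤ.*-zeroʳ (ω S ℤ.- 1ℤ)) (sym (ℤ.*-zeroʳ (ω S)))
  nonempty S (no ¬S) (yes i) = contradiction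
    (VecAll.lookup⁻ λ j → decidable-stable (lookup a j ℕ.≟ 0)
      λ ≢0 → ¬S (j , initial⇒within i j ≢0)) ¬z

-- Left-justified slides

pad : ∀ n → List ℕ → WeakComposition n
pad zero    xs       = []
pad (suc n) []       = 0 ∷ pad n []
pad (suc n) (x ∷ xs) = x ∷ pad n xs

zero-pad : ∀ n → Zero (pad n [])
zero-pad zero    = []
zero-pad (suc n) = refl ∷ zero-pad n

zero⇒≡pad : Zero a → a ≡ pad _ (a ⁺)
zero⇒≡pad []         = refl
zero⇒≡pad (refl ∷ z) = trans (cong (0 ∷_) (trans (zero⇒≡pad z) (cong (pad _) (zero-⁺ z))))
                             (cong (pad _) (sym (zero-⁺ z)))
  where
  zero-⁺ : ∀ {n} {a : WeakComposition n} → Zero a → a ⁺ ≡ []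
  zero-⁺ []         = refl
  zero-⁺ (refl ∷ z) = zero-⁺ z

initial⇒≡pad : Initial ⊤ a → a ≡ pad _ (a ⁺)
initial⇒≡pad []       = refl
initial⇒≡pad (part h) = cong (_ ∷_) (initial⇒≡pad h)
initial⇒≡pad (stop z) = zero⇒≡pad (refl ∷ z)

initial-pad : ∀ n {xs} → All (_≢ 0) xs → Initial ⊤ (pad n xs)
initial-pad zero    _                  = []
initial-pad (suc n) {[]}        _      = stop (zero-pad n)
initial-pad (suc n) {zero ∷ xs} (0≢0 ∷ _) = contradiction refl 0≢0
initial-pad (suc n) {suc x ∷ xs} (_ ∷ ≢0) = part (initial-pad n ≢0)

pad-⁺ : ∀ n {xs} → All (_≢ 0) xs → List.length xs ≤ n → pad n xs ⁺ ≡ xs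
pad-⁺ zero    {[]}         _         _         = refl
pad-⁺ (suc n) {[]}         _         _         = pad-⁺ n [] z≤n
pad-⁺ (suc n) {zero ∷ xs}  (0≢0 ∷ _) _         = contradiction refl 0≢0
pad-⁺ (suc n) {suc x ∷ xs} (_ ∷ ≢0)  (s≤s len) = cong (suc x ∷_) (pad-⁺ n ≢0 len)

sum-take-pad : ∀ n k xs → List.length xs ≤ n →
               sum (List.take k (toList (pad n xs))) ≡ sum (List.take k xs)
sum-take-pad n       zero    xs       _         = refl
sum-take-pad zero    (suc k) []       _         = refl
sum-take-pad (suc n) (suc k) []       _         =
  trans (sum-take-pad n k [] z≤n) (cong sum (List.take-[] k))
sum-take-pad (suc n) (suc k) (x ∷ xs) (s≤s len) = cong (x +_) (sum-take-pad n k xs len)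

sum-take-suc : ∀ k xs → sum (List.take k xs) ≤ sum (List.take (suc k) xs)
sum-take-suc zero    xs       = z≤n
sum-take-suc (suc k) []       = z≤n
sum-take-suc (suc k) (x ∷ xs) = ℕ.+-monoʳ-≤ x (sum-take-suc k xs)

-- Deleting zeros only moves parts to the left, so prefix sums can only grow. This gives the
-- dominance of the left-justified composition over `a`.
sum-take-filter : ∀ k xs →
  sum (List.take k xs) ≤ sum (List.take k (List.filter (λ x → ¬? (x ℕ.≟ 0)) xs))
sum-take-filter zero    xs           = z≤n
sum-take-filter (suc k) []           = z≤n
sum-take-filter (suc k) (zero ∷ xs)  = ℕ.≤-trans (sum-take-filter k xs) (sum-take-suc k _)
sum-take-filter (suc k) (suc x ∷ xs) = ℕ.+-monoʳ-≤ (suc x) (sum-take-filter k xs)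

module _ {n : ℕ} (a : WeakComposition n) where

  private
    length-⁺ : List.length (a ⁺) ≤ n
    length-⁺ = ℕ.≤-trans (List.length-filter (λ x → ¬? (x ℕ.≟ 0)) (toList a))
                         (ℕ.≤-reflexive (Vec.length-toList a))
    ⁺-nonzero : All (_≢ 0) (a ⁺)
    ⁺-nonzero = All.all-filter (λ x → ¬? (x ℕ.≟ 0)) (toList a)

  pad-slide : Slide a (pad n (a ⁺))
  pad-slide = (λ i → ℕ.≤-trans (sum-take-filter (suc (toℕ i)) (toList a))
                (ℕ.≤-reflexive (sym (sum-take-pad n (suc (toℕ i)) (a ⁺) length-⁺)))) ,
              pad-⁺ n ⁺-nonzero length-⁺

  evaluateOn-glide : evaluateOn ⊤ (glide a) ≡ 1ℤ
  evaluateOn-glide = begin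
    evaluateOn ⊤ (glide a)
      ≡⟨ ∑-concatMap kaon (elements (slides a)) _ ⟩
    ∑ (elements (slides a)) (λ b → evaluateOn ⊤ (kaon b))
      ≡⟨ ∑-cong (elements (slides a)) (λ {b} _ → evaluateOn-kaon ⊤ b) ⟩
    ∑ (elements (slides a)) (λ b → 𝟙 (initial? ⊤ b))
      ≡⟨ ∑-finite-single (slides a) _ pad-slide (λ {b} (_ , b⁺≡a⁺) b≢ → 𝟙-no (initial? ⊤ b)
           λ i → b≢ (trans (initial⇒≡pad i) (cong (pad n) b⁺≡a⁺))) ⟩
    𝟙 (initial? ⊤ (pad n (a ⁺)))
      ≡⟨ 𝟙-yes (initial? ⊤ (pad n (a ⁺))) (initial-pad n ⁺-nonzero) ⟩
    1ℤ ∎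

  evaluateOn-quasiLascoux : evaluateOn ⊤ (quasiLascoux a) ≡ 𝟙 (weaklyDecreasing? (a ⁺))
  evaluateOn-quasiLascoux = begin
    evaluateOn ⊤ (quasiLascoux a)
      ≡⟨ ∑-concatMap lascouxAtom (elements (slides a)) _ ⟩
    ∑ (elements (slides a)) (λ b → evaluateOn ⊤ (lascouxAtom b))
      ≡⟨ ∑-cong (elements (slides a)) (λ {b} b∈ → trans (evaluateOn-lascouxAtom-kaon ⊤ b)
           (cong (λ xs → 𝟙 (weaklyDecreasing? xs) ℤ.* evaluateOn ⊤ (kaon b))
                 (proj₂ (Finite.sound (slides a) b∈)))) ⟩
    ∑ (elements (slides a)) (λ b → 𝟙 (weaklyDecreasing? (a ⁺)) ℤ.* evaluateOn ⊤ (kaon b))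
      ≡⟨ ∑-*ˡ (elements (slides a)) (𝟙 (weaklyDecreasing? (a ⁺))) _ ⟩
    𝟙 (weaklyDecreasing? (a ⁺)) ℤ.* ∑ (elements (slides a)) (λ b → evaluateOn ⊤ (kaon b))
      ≡⟨ cong (𝟙 (weaklyDecreasing? (a ⁺)) ℤ.*_)
           (trans (sym (∑-concatMap kaon (elements (slides a)) _)) evaluateOn-glide) ⟩
    𝟙 (weaklyDecreasing? (a ⁺)) ℤ.* 1ℤ
      ≡⟨ ℤ.*-identityʳ _ ⟩
    𝟙 (weaklyDecreasing? (a ⁺)) ∎

  -- Each coefficient is multiplied by 1, written as the weighted sum of all functionals on its
  -- kaon. After the sums are exchanged, the inner one is a functional applied to the whole
  -- expansion, hence to the atom.
  sumAt-kaons : (Q : Family n) → lascouxAtom a ≈ combination Q kaon →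
                sumAt -1ℤ Q ≡ 𝟙 (weaklyDecreasing? (a ⁺))
  sumAt-kaons Q A≈Q = begin
    ∑ (support Q) q
      ≡⟨ ∑-cong (support Q) (λ {b} _ → trans (sym (ℤ.*-identityʳ (q b)))
           (trans (cong (q b ℤ.*_) (sym (kaon-1 b)))
           (trans (sym (∑-*ˡ (subsets n) (q b) _))
                  (∑-cong (subsets n) λ {S} _ → rotate (q b) (ω S) (evaluateOn S (kaon b)))))) ⟩
    ∑ (support Q) (λ b → ∑ (subsets n) (λ S → ω S ℤ.* (q b ℤ.* evaluateOn S (kaon b))))
      ≡⟨ ∑-swap (support Q) (subsets n) _ ⟩
    ∑ (subsets n) (λ S → ∑ (support Q) (λ b → ω S ℤ.* (q b ℤ.* evaluateOn S (kaon b))))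
      ≡⟨ ∑-cong (subsets n) (λ {S} _ → trans (∑-*ˡ (support Q) (ω S) _) (cong (ω S ℤ.*_)
           (trans (sym (evaluate-combination _ Q kaon))
           (trans (sym (evaluate-cong _ (lascouxAtom a) (combination Q kaon) A≈Q))
                  (evaluateOn-lascouxAtom-kaon S a))))) ⟩
    ∑ (subsets n) (λ S → ω S ℤ.* (d ℤ.* evaluateOn S (kaon a)))
      ≡⟨ ∑-cong (subsets n) (λ {S} _ → sym (rotate d (ω S) (evaluateOn S (kaon a)))) ⟩
    ∑ (subsets n) (λ S → d ℤ.* (ω S ℤ.* evaluateOn S (kaon a)))
      ≡⟨ ∑-*ˡ (subsets n) d _ ⟩
    d ℤ.* ∑ (subsets n) (λ S → ω S ℤ.* evaluateOn S (kaon a))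
      ≡⟨ trans (cong (d ℤ.*_) (kaon-1 a)) (ℤ.*-identityʳ d) ⟩
    d ∎
    where
    d = 𝟙 (weaklyDecreasing? (a ⁺))
    q : WeakComposition n → ℤ
    q b = eval (coeff Q b) -1ℤ
    kaon-1 : ∀ b → ∑ (subsets n) (λ S → ω S ℤ.* evaluateOn S (kaon b)) ≡ 1ℤ
    kaon-1 b = trans (∑-cong (subsets n) (λ {S} _ → cong (ω S ℤ.*_) (evaluateOn-kaon S b)))
                     (∑-ω-initial b)
    rotate : ∀ x y z → x ℤ.* (y ℤ.* z) ≡ y ℤ.* (x ℤ.* z)
    rotate = solve-∀

sumAt-glides : (a : WeakComposition n) (M : Family n) → quasiLascoux a ≈ combination M glide →
               sumAt -1ℤ M ≡ 𝟙 (weaklyDecreasing? (a ⁺))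
sumAt-glides {n} a M Q≈M = begin
  ∑ (support M) μ
    ≡⟨ ∑-cong (support M) (λ {b} _ → trans (sym (ℤ.*-identityʳ (μ b)))
         (cong (μ b ℤ.*_) (sym (evaluateOn-glide b)))) ⟩
  ∑ (support M) (λ b → μ b ℤ.* evaluateOn ⊤ (glide b))
    ≡⟨ evaluate-combination _ M glide ⟨
  evaluateOn ⊤ (combination M glide)
    ≡⟨ evaluate-cong _ (quasiLascoux a) (combination M glide) Q≈M ⟨
  evaluateOn ⊤ (quasiLascoux a)
    ≡⟨ evaluateOn-quasiLascoux a ⟩
  𝟙 (weaklyDecreasing? (a ⁺)) ∎
  where
  μ : WeakComposition n → ℤ
  μ b = eval (coeff M b) -1ℤ

theorem1 : (n : ℕ) → 1 ≤ n → (a : WeakComposition n) (Q M : Family n) →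
    lascouxAtom a ≈ combination Q kaon →
    quasiLascoux a ≈ combination M glide →
    (WeaklyDecreasing (a ⁺) → sumAt -1ℤ Q ≡ 1ℤ × sumAt -1ℤ M ≡ 1ℤ)
    × (¬ WeaklyDecreasing (a ⁺) → sumAt -1ℤ Q ≡ 0ℤ × sumAt -1ℤ M ≡ 0ℤ)
theorem1 n _ a Q M A≈Q Q≈M =
  (λ d → trans Q-sum (𝟙-yes d? d) , trans M-sum (𝟙-yes d? d)) ,
  (λ ¬d → trans Q-sum (𝟙-no d? ¬d) , trans M-sum (𝟙-no d? ¬d))
  where
  d? = weaklyDecreasing? (a ⁺)
  Q-sum = sumAt-kaons a Q A≈Q
  M-sum = sumAt-glides a M Q≈M
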